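{- For integers $1\le r\le n$, \[ B_q(n,r)=\frac{[2n-1]!_q\,[2r]_q}{[n+r]!_q\,[n-r]!_q} = \sum_{\pi \in \mathcal{B}(n,r)} q^{\operatorname{maj}(\pi) - \operatorname{des}(\pi)}, \] and also $B_q(n,r)=q^{ -(n-r)}\left(\left[{2n-1\atop n+r-1}\right]_q-\left[{2n-1\atop n+r}\right]_q\right)$.
   Context: Let $[r]_q=1+q+\cdots+q^{r-1}$, $[n]!_q=\prod_{r=1}^n[r]_q$, and $\left[{a\atop b}\right]_q$ be the Gaussian binomial coefficient. Paths use up steps $(1,1)$ and down steps $(1,-1)$ and are written as 0-1 sequences $\pi=\pi_1\cdots\pi_\ell$, with $0$ for up and $1$ for down. The descent set is $D(\pi)=\{i:\pi_i>\pi_{i+1}\}$, $\operatorname{maj}(\pi)=\sum_{i\in D(\pi)}i$, and $\operatorname{des}(\pi)=|D(\pi)|$. $\mathcal{B}(n,r)$ is the set of paths of length $2n$ that start at the origin with an up step, end at $(2n,-2r+2)$, and never go below the line $y=-2r+2$. In particular $\mathcal{B}(n,1)$ is the set of Catalan (Dyck) paths of length $2n$. -}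

module Defs where

open import Data.Bool using (if_then_else_)
open import Data.Empty using (⊥)
open import Data.Fin as Fin using (Fin; zero; suc; fromℕ)
import Data.Fin.Properties as Fin
open import Data.Integer as ℤ using (ℤ; +_; 0ℤ; 1ℤ; -1ℤ)
import Data.Integer.Properties as ℤ
open import Data.List using (List; []; _∷_; map; replicate; foldr; filter; length; _++_)
open import Data.Nat as ℕ using (ℕ; zero; suc; _∸_)
open import Data.Nat.ListAction using (sum)
open import Data.Product using (_×_; _,_)
open import Data.Sum using (inj₁; inj₂)
open import Data.Vec using (Vec; []; _∷_)
open import Relation.Binary.PropositionalEquality using (_≡_; refl; sym; trans; cong)
open import Relation.Nullary using (¬_; Dec; yes; no; does; contradiction; _×-dec_)

-- ℤ[q]: the entry at index k of the list is the coefficient of q^k.  Trailing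
-- zeros are allowed, so equality is the coefficientwise relation _≈_.

Poly : Set
Poly = List ℤ

coeff : Poly → ℕ → ℤ
coeff []      _       = 0ℤ
coeff (a ∷ p) zero    = a
coeff (a ∷ p) (suc k) = coeff p k

infix 4 _≈_ _≉_

record _≈_ (p p′ : Poly) : Set where
  constructor coeffwise
  field
    coeff-≡ : ∀ k → coeff p k ≡ coeff p′ k

open _≈_ public

_≉_ : Poly → Poly → Set
p ≉ p′ = ¬ (p ≈ p′)

infixl 6 _+ₚ_ _-ₚ_
infixl 7 _*ₚ_ _·ₚ_
infix  8 -ₚ_

0ₚ 1ₚ : Poly
0ₚ = []
1ₚ = 1ℤ ∷ []

_+ₚ_ : Poly → Poly → Poly
[]      +ₚ p′       = p′
(a ∷ p) +ₚ []       = a ∷ p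
(a ∷ p) +ₚ (b ∷ p′) = (a ℤ.+ b) ∷ (p +ₚ p′)

_·ₚ_ : ℤ → Poly → Poly
a ·ₚ p = map (a ℤ.*_) p

-ₚ_ : Poly → Poly
-ₚ p = map ℤ.-_ p

_-ₚ_ : Poly → Poly → Poly
p -ₚ p′ = p +ₚ (-ₚ p′)

_*ₚ_ : Poly → Poly → Poly
[]      *ₚ p′ = []
(a ∷ p) *ₚ p′ = (a ·ₚ p′) +ₚ (0ℤ ∷ (p *ₚ p′))

sumₚ : List Poly → Poly
sumₚ = foldr _+ₚ_ 0ₚ

infix 9 q^_

q^_ : ℕ → Poly
q^ zero  = 1ₚ
q^ suc k = 0ℤ ∷ q^ k

coeff-+ : ∀ p p′ k → coeff (p +ₚ p′) k ≡ coeff p k ℤ.+ coeff p′ k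
coeff-+ []      p′       k       = sym (ℤ.+-identityˡ _)
coeff-+ (a ∷ p) []       k       = sym (ℤ.+-identityʳ _)
coeff-+ (a ∷ p) (b ∷ p′) zero    = refl
coeff-+ (a ∷ p) (b ∷ p′) (suc k) = coeff-+ p p′ k

coeff-· : ∀ a p k → coeff (a ·ₚ p) k ≡ a ℤ.* coeff p k
coeff-· a []      k       = sym (ℤ.*-zeroʳ a)
coeff-· a (b ∷ p) zero    = refl
coeff-· a (b ∷ p) (suc k) = coeff-· a p k

coeff-∷* : ∀ a p p′ k →
  coeff ((a ∷ p) *ₚ p′) k ≡ a ℤ.* coeff p′ k ℤ.+ coeff (0ℤ ∷ (p *ₚ p′)) k
coeff-∷* a p p′ k =
  trans (coeff-+ (a ·ₚ p′) _ k) (cong (ℤ._+ _) (coeff-· a p′ k))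

coeff-*-zero : ∀ p p′ → coeff (p *ₚ p′) 0 ≡ coeff p 0 ℤ.* coeff p′ 0
coeff-*-zero []      p′ = refl
coeff-*-zero (a ∷ p) p′ = trans (coeff-∷* a p p′ 0) (ℤ.+-identityʳ _)

coeff-*-shift : ∀ p p′ k → coeff (p *ₚ (0ℤ ∷ p′)) (suc k) ≡ coeff (p *ₚ p′) k
coeff-*-shift []      p′ k = refl
coeff-*-shift (a ∷ p) p′ k =
  trans (coeff-∷* a p (0ℤ ∷ p′) (suc k))
        (trans (cong (λ z → a ℤ.* coeff p′ k ℤ.+ z) (tail k)) (sym (coeff-∷* a p p′ k)))
  where
  tail : ∀ k → coeff (p *ₚ (0ℤ ∷ p′)) k ≡ coeff (0ℤ ∷ (p *ₚ p′)) k
  tail zero    = trans (coeff-*-zero p (0ℤ ∷ p′)) (ℤ.*-zeroʳ (coeff p 0))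
  tail (suc k) = coeff-*-shift p p′ k

0∷-≈0 : ∀ {p} → p ≈ 0ₚ → (0ℤ ∷ p) ≈ 0ₚ
0∷-≈0 p≈0 = coeffwise λ { zero → refl ; (suc k) → coeff-≡ p≈0 k }

*-≉0 : ∀ p p′ → p ≉ 0ₚ → p′ ≉ 0ₚ → p *ₚ p′ ≉ 0ₚ
*-≉0 []      p′ p≉0 p′≉0 pp′≈0 = p≉0 pp′≈0
*-≉0 (a ∷ p) p′ p≉0 p′≉0 pp′≈0 with a ℤ.≟ 0ℤ
... | yes refl = *-≉0 p p′ (λ p≈0 → p≉0 (0∷-≈0 p≈0)) p′≉0
  (coeffwise λ k → trans (sym (ℤ.+-identityˡ _))
    (trans (sym (coeff-∷* 0ℤ p p′ (suc k))) (coeff-≡ pp′≈0 (suc k))))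
... | no a≢0 = go p′ p′≉0 pp′≈0
  where
  go : ∀ r → r ≉ 0ₚ → (a ∷ p) *ₚ r ≉ 0ₚ
  go []      r≉0 _    = r≉0 (coeffwise λ _ → refl)
  go (b ∷ r) r≉0 pr≈0
    with ℤ.i*j≡0⇒i≡0∨j≡0 a
           (trans (sym (coeff-*-zero (a ∷ p) (b ∷ r))) (coeff-≡ pr≈0 0))
  ... | inj₁ a≡0  = a≢0 a≡0
  ... | inj₂ refl = go r (λ r≈0 → r≉0 (0∷-≈0 r≈0))
    (coeffwise λ k → trans (sym (coeff-*-shift (a ∷ p) r k)) (coeff-≡ pr≈0 (suc k)))

1≉0 : 1ₚ ≉ 0ₚ
1≉0 e with coeff-≡ e 0
... | ()

q^-≉0 : ∀ k → q^ k ≉ 0ₚ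
q^-≉0 zero    e = 1≉0 e
q^-≉0 (suc k) e = q^-≉0 k (coeffwise λ j → coeff-≡ e (suc j))

-- The fraction field ℚ(q) of ℤ[q], in the style of ℚᵘ: unreduced fractions,
-- compared by cross-multiplication.

infix 4 _≃_
infixl 6 _-ᶠ_
infixl 7 _*ᶠ_

record Frac : Set where
  constructor mkFrac
  field
    num   : Poly
    den   : Poly
    den≉0 : den ≉ 0ₚ

open Frac public

record _≃_ (x y : Frac) : Set where
  constructor *≈*
  field
    cross : num x *ₚ den y ≈ num y *ₚ den x

open _≃_ public

fromPoly : Poly → Frac
fromPoly p = mkFrac p 1ₚ 1≉0

_-ᶠ_ : Frac → Frac → Frac
mkFrac a b b≉0 -ᶠ mkFrac c d d≉0 =
  mkFrac (a *ₚ d -ₚ c *ₚ b) (b *ₚ d) (*-≉0 b d b≉0 d≉0)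

_*ᶠ_ : Frac → Frac → Frac
mkFrac a b b≉0 *ᶠ mkFrac c d d≉0 = mkFrac (a *ₚ c) (b *ₚ d) (*-≉0 b d b≉0 d≉0)

q^-_ : ℕ → Frac
q^- k = mkFrac 1ₚ (q^ k) (q^-≉0 k)

[_]q : ℕ → Poly
[ r ]q = replicate r 1ℤ

[_]!q : ℕ → Poly
[ zero  ]!q = 1ₚ
[ suc n ]!q = [ n ]!q *ₚ [ suc n ]q

[]q-≉0 : ∀ r → [ suc r ]q ≉ 0ₚ
[]q-≉0 r e with coeff-≡ e 0
... | ()

[]!q-≉0 : ∀ n → [ n ]!q ≉ 0ₚ
[]!q-≉0 zero    = 1≉0
[]!q-≉0 (suc n) = *-≉0 [ n ]!q [ suc n ]q ([]!q-≉0 n) ([]q-≉0 n)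

[]!q*[]!q-≉0 : ∀ m n → [ m ]!q *ₚ [ n ]!q ≉ 0ₚ
[]!q*[]!q-≉0 m n = *-≉0 [ m ]!q [ n ]!q ([]!q-≉0 m) ([]!q-≉0 n)

-- The Gaussian binomial coefficient [a choose b]_q is zero when b > a.
gauss : ℕ → ℕ → Frac
gauss a b =
  if does (b ℕ.≤? a)
  then mkFrac [ a ]!q ([ b ]!q *ₚ [ a ∸ b ]!q) ([]!q*[]!q-≉0 b (a ∸ b))
  else fromPoly 0ₚ

-- Meant for 1 ≤ r ≤ n, where the subtractions are not truncated.
B : ℕ → ℕ → Frac
B n r = mkFrac ([ 2 ℕ.* n ∸ 1 ]!q *ₚ [ 2 ℕ.* r ]q)
               ([ n ℕ.+ r ]!q *ₚ [ n ∸ r ]!q)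
               ([]!q*[]!q-≉0 (n ℕ.+ r) (n ∸ r))

pattern up   = zero
pattern down = suc zero

Path : ℕ → Set
Path ℓ = Vec (Fin 2) ℓ

allPaths : ∀ ℓ → List (Path ℓ)
allPaths zero    = [] ∷ []
allPaths (suc ℓ) = map (up ∷_) (allPaths ℓ) ++ map (down ∷_) (allPaths ℓ)

step : Fin 2 → ℤ
step up   = 1ℤ
step down = -1ℤ

-- The y-coordinate of the path at x = i, for 0 ≤ i ≤ ℓ.
height : ∀ {ℓ} → Path ℓ → Fin (suc ℓ) → ℤ
height π       zero    = 0ℤ
height (s ∷ π) (suc i) = step s ℤ.+ height π i

StartsUp : ∀ {ℓ} → Path ℓ → Set
StartsUp []      = ⊥
StartsUp (s ∷ π) = s ≡ up

startsUp? : ∀ {ℓ} (π : Path ℓ) → Dec (StartsUp π)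
startsUp? []      = no λ ()
startsUp? (s ∷ π) = s Fin.≟ up

bottom : ℕ → ℤ
bottom r = ℤ.- (+ (2 ℕ.* r)) ℤ.+ + 2

In𝓑 : ∀ n r → Path (2 ℕ.* n) → Set
In𝓑 n r π =
  StartsUp π × height π (fromℕ (2 ℕ.* n)) ≡ bottom r × (∀ i → bottom r ℤ.≤ height π i)

in𝓑? : ∀ n r (π : Path (2 ℕ.* n)) → Dec (In𝓑 n r π)
in𝓑? n r π =
  startsUp? π ×-dec (height π (fromℕ (2 ℕ.* n)) ℤ.≟ bottom r)
              ×-dec Fin.all? (λ i → bottom r ℤ.≤? height π i)

𝓑 : ∀ n r → List (Path (2 ℕ.* n))
𝓑 n r = filter (in𝓑? n r) (allPaths (2 ℕ.* n))

-- The descent positions of a word whose first letter has position i.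
descentsFrom : ∀ {ℓ} → ℕ → Path ℓ → List ℕ
descentsFrom i []          = []
descentsFrom i (s ∷ [])    = []
descentsFrom i (s ∷ t ∷ π) =
  if does (t Fin.<? s)
  then i ∷ descentsFrom (suc i) (t ∷ π)
  else descentsFrom (suc i) (t ∷ π)

D : ∀ {ℓ} → Path ℓ → List ℕ
D = descentsFrom 1

maj des : ∀ {ℓ} → Path ℓ → ℕ
maj π = sum (D π)
des π = length (D π)

-- Descent positions are at least 1, so des π ≤ maj π and ∸ is exact.
majDesSum : ℕ → ℕ → Poly
majDesSum n r = sumₚ (map (λ π → q^ (maj π ∸ des π)) (𝓑 n r))

{-# OPTIONS --safe #-}

-- Dropping the initial up step turns maj − des into maj, so the paths become words
-- with a = n − r ups and n + r − 1 downs that never sink more than k = 2r − 1 below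
-- their start.  Removing last letters, let T(ℓ, e) be the maj-generating function of
-- the words of length ℓ ending at distance e above the floor, and U(ℓ, e) that of
-- the words of length ℓ + 1 among these that end with an up step.  Then
--   T(ℓ+1, e)   = U(ℓ, e) + T(ℓ, e+1),
--   U(ℓ+1, e+1) = U(ℓ, e) + q^(ℓ+1) T(ℓ, e+1),   U(ℓ, 0) = 0,
-- and the two q-Pascal rules show that, a being the number of ups of the word
-- (without its last letter in the case of U),
--   T = [ℓ; a] − q^(k+1) [ℓ; a+k+1],   U = q^(ℓ−a) ([ℓ; a] − [ℓ; a+k+1]),
-- where the boundary condition U(ℓ, 0) = 0 is the symmetry of the binomials.  The
-- product formulas follow from [n+r] − q^(2r) [n−r] = [2r] and
-- [n+r] − [n−r] = q^(n−r) [2r].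

module Submission where

open import Algebra.Bundles using (CommutativeRing; CommutativeSemigroup)
import Algebra.Properties.CommutativeSemigroup as CommutativeSemigroupProperties
open import Algebra.Structures using (IsAbelianGroup)
open import Data.Bool using (true; false; if_then_else_)
open import Data.Fin as Fin using (Fin; zero; suc; fromℕ)
open import Data.Integer as ℤ using (ℤ; +_; 0ℤ; 1ℤ; -1ℤ)
import Data.Integer.Properties as ℤ
open import Data.Integer.Tactic.RingSolver using (solve-∀)
open import Data.List using ([]; _∷_; map; filter; length; _++_)
open import Data.List.Properties using (map-++; map-∘)
open import Data.Maybe using (Maybe; just; nothing; _>>=_)
open import Data.Maybe.Properties using (just-injective) renaming (≡-dec to ≡-decMaybe)
open import Data.Nat using (ℕ; zero; suc; _+_; _*_; _∸_; _≤_; _<_; z≤n; s≤s; _≟_; _≤?_)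
open import Data.Nat.ListAction using (sum)
open import Data.Nat.Properties
  using ( +-comm; +-assoc; +-suc; +-identityʳ; m+n∸n≡m; m+n∸m≡n; m∸n+n≡m; ≤-trans; ≤-reflexive
        ; m≤m+n; m≤n+m; n<1+n; m<n⇒m<1+n; ≰⇒>; <⇒≢; <⇒≤; <⇒≱; suc-injective; m≤n⇒∃[o]m+o≡n )
open import Data.Nat.Tactic.RingSolver using () renaming (solve-∀ to solveℕ-∀)
open import Data.Product using (_×_; _,_; proj₁; proj₂)
open import Data.Vec using ([]; _∷_; _∷ʳ_; initLast)
open import Function using (_∘_; _⇔_; mk⇔)
open import Level using (0ℓ)
open import Relation.Binary using (IsEquivalence)
import Relation.Binary.Reasoning.Setoid as SetoidReasoning
open import Relation.Binary.PropositionalEquality as ≡ using (_≡_; _≢_; refl; cong; cong₂; subst)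
open import Relation.Nullary using (Dec; yes; no; does)
open import Relation.Nullary.Decidable using (does-⇔; dec-true; dec-false)
open import Relation.Unary using (Decidable)
open import Tactic.RingSolver.Core.AlmostCommutativeRing using (AlmostCommutativeRing; fromCommutativeRing)
import Tactic.RingSolver.NonReflective as RingSolver
open import Defs

-- The commutative ring ℤ[q] and its ring solver.

≈-refl : ∀ {p} → p ≈ p
≈-refl = coeffwise λ _ → refl

≈-sym : ∀ {p p′} → p ≈ p′ → p′ ≈ p
≈-sym e = coeffwise λ k → ≡.sym (coeff-≡ e k)

≈-trans : ∀ {p p′ p″} → p ≈ p′ → p′ ≈ p″ → p ≈ p″
≈-trans e e′ = coeffwise λ k → ≡.trans (coeff-≡ e k) (coeff-≡ e′ k)

≈-reflexive : ∀ {p p′} → p ≡ p′ → p ≈ p′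
≈-reflexive refl = ≈-refl

≈-isEquivalence : IsEquivalence _≈_
≈-isEquivalence = record { refl = ≈-refl ; sym = ≈-sym ; trans = ≈-trans }

coeff-neg : ∀ p k → coeff (-ₚ p) k ≡ ℤ.- coeff p k
coeff-neg []      k       = refl
coeff-neg (a ∷ p) zero    = refl
coeff-neg (a ∷ p) (suc k) = coeff-neg p k

∷-cong : ∀ {a b p p′} → a ≡ b → p ≈ p′ → (a ∷ p) ≈ (b ∷ p′)
∷-cong a≡b e = coeffwise λ { zero → a≡b ; (suc k) → coeff-≡ e k }

+ₚ-cong : ∀ {p p′ r r′} → p ≈ p′ → r ≈ r′ → p +ₚ r ≈ p′ +ₚ r′
+ₚ-cong {p} {p′} {r} {r′} e e′ = coeffwise λ k → begin
  coeff (p +ₚ r) k           ≡⟨ coeff-+ p r k ⟩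
  coeff p k ℤ.+ coeff r k    ≡⟨ cong₂ ℤ._+_ (coeff-≡ e k) (coeff-≡ e′ k) ⟩
  coeff p′ k ℤ.+ coeff r′ k  ≡⟨ coeff-+ p′ r′ k ⟨
  coeff (p′ +ₚ r′) k         ∎
  where open ≡.≡-Reasoning

+ₚ-assoc : ∀ p r s → (p +ₚ r) +ₚ s ≈ p +ₚ (r +ₚ s)
+ₚ-assoc p r s = coeffwise λ k → begin
  coeff (p +ₚ r +ₚ s) k                      ≡⟨ coeff-+ (p +ₚ r) s k ⟩
  coeff (p +ₚ r) k ℤ.+ coeff s k             ≡⟨ cong (ℤ._+ coeff s k) (coeff-+ p r k) ⟩
  coeff p k ℤ.+ coeff r k ℤ.+ coeff s k      ≡⟨ ℤ.+-assoc (coeff p k) _ _ ⟩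
  coeff p k ℤ.+ (coeff r k ℤ.+ coeff s k)    ≡⟨ cong (λ c → coeff p k ℤ.+ c) (coeff-+ r s k) ⟨
  coeff p k ℤ.+ coeff (r +ₚ s) k             ≡⟨ coeff-+ p (r +ₚ s) k ⟨
  coeff (p +ₚ (r +ₚ s)) k                    ∎
  where open ≡.≡-Reasoning

+ₚ-comm : ∀ p r → p +ₚ r ≈ r +ₚ p
+ₚ-comm p r = coeffwise λ k →
  ≡.trans (coeff-+ p r k) (≡.trans (ℤ.+-comm (coeff p k) _) (≡.sym (coeff-+ r p k)))

+ₚ-identityʳ : ∀ p → p +ₚ 0ₚ ≈ p
+ₚ-identityʳ []      = ≈-refl
+ₚ-identityʳ (a ∷ p) = ≈-refl

-ₚ-cong : ∀ {p p′} → p ≈ p′ → -ₚ p ≈ -ₚ p′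
-ₚ-cong {p} {p′} e = coeffwise λ k →
  ≡.trans (coeff-neg p k) (≡.trans (cong ℤ.-_ (coeff-≡ e k)) (≡.sym (coeff-neg p′ k)))

-ₚ-inverseʳ : ∀ p → p +ₚ (-ₚ p) ≈ 0ₚ
-ₚ-inverseʳ p = coeffwise λ k →
  ≡.trans (coeff-+ p (-ₚ p) k)
    (≡.trans (cong (λ c → coeff p k ℤ.+ c) (coeff-neg p k)) (ℤ.+-inverseʳ (coeff p k)))

-ₚ-inverseˡ : ∀ p → (-ₚ p) +ₚ p ≈ 0ₚ
-ₚ-inverseˡ p = ≈-trans (+ₚ-comm (-ₚ p) p) (-ₚ-inverseʳ p)

+ₚ-isAbelianGroup : IsAbelianGroup _≈_ _+ₚ_ 0ₚ (λ p → -ₚ p)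
+ₚ-isAbelianGroup = record
  { isGroup = record
    { isMonoid = record
      { isSemigroup = record
        { isMagma = record { isEquivalence = ≈-isEquivalence ; ∙-cong = +ₚ-cong }
        ; assoc   = +ₚ-assoc
        }
      ; identity = (λ _ → ≈-refl) , +ₚ-identityʳ
      }
    ; inverse = -ₚ-inverseˡ , -ₚ-inverseʳ
    ; ⁻¹-cong = -ₚ-cong
    }
  ; comm = +ₚ-comm
  }

+ₚ-commutativeSemigroup : CommutativeSemigroup 0ℓ 0ℓ
+ₚ-commutativeSemigroup = record
  { isCommutativeSemigroup = IsAbelianGroup.isCommutativeSemigroup +ₚ-isAbelianGroup }

open CommutativeSemigroupProperties +ₚ-commutativeSemigroup using () renaming (interchange to +ₚ-interchange)

·ₚ-cong : ∀ a {p p′} → p ≈ p′ → a ·ₚ p ≈ a ·ₚ p′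
·ₚ-cong a {p} {p′} e = coeffwise λ k →
  ≡.trans (coeff-· a p k) (≡.trans (cong (a ℤ.*_) (coeff-≡ e k)) (≡.sym (coeff-· a p′ k)))

·ₚ-distribˡ-+ₚ : ∀ a p r → a ·ₚ (p +ₚ r) ≈ a ·ₚ p +ₚ a ·ₚ r
·ₚ-distribˡ-+ₚ a p r = coeffwise λ k → begin
  coeff (a ·ₚ (p +ₚ r)) k                    ≡⟨ coeff-· a (p +ₚ r) k ⟩
  a ℤ.* coeff (p +ₚ r) k                     ≡⟨ cong (a ℤ.*_) (coeff-+ p r k) ⟩
  a ℤ.* (coeff p k ℤ.+ coeff r k)            ≡⟨ ℤ.*-distribˡ-+ a _ _ ⟩
  a ℤ.* coeff p k ℤ.+ a ℤ.* coeff r k        ≡⟨ cong₂ ℤ._+_ (coeff-· a p k) (coeff-· a r k) ⟨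
  coeff (a ·ₚ p) k ℤ.+ coeff (a ·ₚ r) k      ≡⟨ coeff-+ (a ·ₚ p) _ k ⟨
  coeff (a ·ₚ p +ₚ a ·ₚ r) k                 ∎
  where open ≡.≡-Reasoning

·ₚ-assoc : ∀ a b p → (a ℤ.* b) ·ₚ p ≈ a ·ₚ (b ·ₚ p)
·ₚ-assoc a b p = coeffwise λ k → begin
  coeff ((a ℤ.* b) ·ₚ p) k     ≡⟨ coeff-· (a ℤ.* b) p k ⟩
  a ℤ.* b ℤ.* coeff p k        ≡⟨ ℤ.*-assoc a b _ ⟩
  a ℤ.* (b ℤ.* coeff p k)      ≡⟨ cong (a ℤ.*_) (coeff-· b p k) ⟨
  a ℤ.* coeff (b ·ₚ p) k       ≡⟨ coeff-· a (b ·ₚ p) k ⟨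
  coeff (a ·ₚ (b ·ₚ p)) k      ∎
  where open ≡.≡-Reasoning

1·ₚ : ∀ p → 1ℤ ·ₚ p ≈ p
1·ₚ p = coeffwise λ k → ≡.trans (coeff-· 1ℤ p k) (ℤ.*-identityˡ _)

0·ₚ : ∀ p → 0ℤ ·ₚ p ≈ 0ₚ
0·ₚ p = coeffwise (coeff-· 0ℤ p)

open IsAbelianGroup +ₚ-isAbelianGroup using () renaming (setoid to ≈-setoid)
module ≈-Reasoning = SetoidReasoning ≈-setoid

*ₚ-zeroʳ : ∀ p → p *ₚ 0ₚ ≈ 0ₚ
*ₚ-zeroʳ []      = ≈-refl
*ₚ-zeroʳ (a ∷ p) = 0∷-≈0 (*ₚ-zeroʳ p)

-- Multiplication recurses on its left factor; this is the mirror recursion on the right factor,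
-- from which commutativity follows by induction.
*ₚ-∷ʳ : ∀ p b r → p *ₚ (b ∷ r) ≈ b ·ₚ p +ₚ (0ℤ ∷ (p *ₚ r))
*ₚ-∷ʳ []      b r = ≈-sym (0∷-≈0 ≈-refl)
*ₚ-∷ʳ (a ∷ p) b r =
  ∷-cong (cong (ℤ._+ 0ℤ) (ℤ.*-comm a b)) (begin
    a ·ₚ r +ₚ p *ₚ (b ∷ r)                    ≈⟨ +ₚ-cong ≈-refl (*ₚ-∷ʳ p b r) ⟩
    a ·ₚ r +ₚ (b ·ₚ p +ₚ (0ℤ ∷ (p *ₚ r)))     ≈⟨ +ₚ-assoc (a ·ₚ r) _ _ ⟨
    a ·ₚ r +ₚ b ·ₚ p +ₚ (0ℤ ∷ (p *ₚ r))       ≈⟨ +ₚ-cong (+ₚ-comm (a ·ₚ r) _) ≈-refl ⟩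
    b ·ₚ p +ₚ a ·ₚ r +ₚ (0ℤ ∷ (p *ₚ r))       ≈⟨ +ₚ-assoc (b ·ₚ p) _ _ ⟩
    b ·ₚ p +ₚ (a ·ₚ r +ₚ (0ℤ ∷ (p *ₚ r)))     ∎)
  where open ≈-Reasoning

*ₚ-comm : ∀ p r → p *ₚ r ≈ r *ₚ p
*ₚ-comm []      r = ≈-sym (*ₚ-zeroʳ r)
*ₚ-comm (a ∷ p) r =
  ≈-trans (+ₚ-cong ≈-refl (∷-cong refl (*ₚ-comm p r))) (≈-sym (*ₚ-∷ʳ r a p))

*ₚ-congˡ : ∀ p {r r′} → r ≈ r′ → p *ₚ r ≈ p *ₚ r′
*ₚ-congˡ []      e = ≈-refl
*ₚ-congˡ (a ∷ p) e = +ₚ-cong (·ₚ-cong a e) (∷-cong refl (*ₚ-congˡ p e))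

*ₚ-cong : ∀ {p p′ r r′} → p ≈ p′ → r ≈ r′ → p *ₚ r ≈ p′ *ₚ r′
*ₚ-cong {p} {p′} {r} {r′} e e′ = begin
  p *ₚ r     ≈⟨ *ₚ-congˡ p e′ ⟩
  p *ₚ r′    ≈⟨ *ₚ-comm p r′ ⟩
  r′ *ₚ p    ≈⟨ *ₚ-congˡ r′ e ⟩
  r′ *ₚ p′   ≈⟨ *ₚ-comm r′ p′ ⟩
  p′ *ₚ r′   ∎
  where open ≈-Reasoning

*ₚ-distribˡ-+ₚ : ∀ p r s → p *ₚ (r +ₚ s) ≈ p *ₚ r +ₚ p *ₚ s
*ₚ-distribˡ-+ₚ []      r s = ≈-refl
*ₚ-distribˡ-+ₚ (a ∷ p) r s =
  ≈-trans (+ₚ-cong (·ₚ-distribˡ-+ₚ a r s) (∷-cong refl (*ₚ-distribˡ-+ₚ p r s)))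
          (+ₚ-interchange (a ·ₚ r) _ _ _)

*ₚ-distribʳ-+ₚ : ∀ p r s → (r +ₚ s) *ₚ p ≈ r *ₚ p +ₚ s *ₚ p
*ₚ-distribʳ-+ₚ p r s =
  ≈-trans (*ₚ-comm (r +ₚ s) p)
    (≈-trans (*ₚ-distribˡ-+ₚ p r s) (+ₚ-cong (*ₚ-comm p r) (*ₚ-comm p s)))

0∷-*ₚ : ∀ p r → (0ℤ ∷ p) *ₚ r ≈ 0ℤ ∷ (p *ₚ r)
0∷-*ₚ p r = +ₚ-cong (0·ₚ r) ≈-refl

·ₚ-*ₚ-assoc : ∀ a p r → (a ·ₚ p) *ₚ r ≈ a ·ₚ (p *ₚ r)
·ₚ-*ₚ-assoc a []      r = ≈-refl
·ₚ-*ₚ-assoc a (b ∷ p) r = begin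
  (a ℤ.* b) ·ₚ r +ₚ (0ℤ ∷ ((a ·ₚ p) *ₚ r))      ≈⟨ +ₚ-cong (·ₚ-assoc a b r)
                                                    (∷-cong (≡.sym (ℤ.*-zeroʳ a)) (·ₚ-*ₚ-assoc a p r)) ⟩
  a ·ₚ (b ·ₚ r) +ₚ a ·ₚ (0ℤ ∷ (p *ₚ r))          ≈⟨ ·ₚ-distribˡ-+ₚ a (b ·ₚ r) _ ⟨
  a ·ₚ (b ·ₚ r +ₚ (0ℤ ∷ (p *ₚ r)))               ∎
  where open ≈-Reasoning

*ₚ-assoc : ∀ p r s → (p *ₚ r) *ₚ s ≈ p *ₚ (r *ₚ s)
*ₚ-assoc []      r s = ≈-refl
*ₚ-assoc (a ∷ p) r s = begin
  (a ·ₚ r +ₚ (0ℤ ∷ (p *ₚ r))) *ₚ s              ≈⟨ *ₚ-distribʳ-+ₚ s (a ·ₚ r) _ ⟩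
  (a ·ₚ r) *ₚ s +ₚ (0ℤ ∷ (p *ₚ r)) *ₚ s         ≈⟨ +ₚ-cong (·ₚ-*ₚ-assoc a r s) (0∷-*ₚ (p *ₚ r) s) ⟩
  a ·ₚ (r *ₚ s) +ₚ (0ℤ ∷ ((p *ₚ r) *ₚ s))       ≈⟨ +ₚ-cong ≈-refl (∷-cong refl (*ₚ-assoc p r s)) ⟩
  a ·ₚ (r *ₚ s) +ₚ (0ℤ ∷ (p *ₚ (r *ₚ s)))       ∎
  where open ≈-Reasoning

*ₚ-identityˡ : ∀ p → 1ₚ *ₚ p ≈ p
*ₚ-identityˡ p =
  ≈-trans (+ₚ-cong (1·ₚ p) (0∷-≈0 ≈-refl)) (+ₚ-identityʳ p)

*ₚ-identityʳ : ∀ p → p *ₚ 1ₚ ≈ p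
*ₚ-identityʳ p = ≈-trans (*ₚ-comm p 1ₚ) (*ₚ-identityˡ p)

Poly-commutativeRing : CommutativeRing 0ℓ 0ℓ
Poly-commutativeRing = record
  { Carrier = Poly
  ; _≈_     = _≈_
  ; _+_     = _+ₚ_
  ; _*_     = _*ₚ_
  ; -_      = λ p → -ₚ p
  ; 0#      = 0ₚ
  ; 1#      = 1ₚ
  ; isCommutativeRing = record
    { isRing = record
      { +-isAbelianGroup = +ₚ-isAbelianGroup
      ; *-cong           = *ₚ-cong
      ; *-assoc          = *ₚ-assoc
      ; *-identity       = *ₚ-identityˡ , *ₚ-identityʳ
      ; distrib          = *ₚ-distribˡ-+ₚ , *ₚ-distribʳ-+ₚ
      }
    ; *-comm = *ₚ-comm
    }
  }

-- The solver drops coefficients that pass this test. It has to accept lists of zeros as well as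
-- `[]`, because cancellation leaves trailing zeros behind.
0≟ₚ_ : ∀ p → Maybe (0ₚ ≈ p)
0≟ₚ []      = just ≈-refl
0≟ₚ (a ∷ p) with a ℤ.≟ 0ℤ | 0≟ₚ p
... | yes refl | just e = just (≈-sym (0∷-≈0 (≈-sym e)))
... | _        | _      = nothing

Poly-almostCommutativeRing : AlmostCommutativeRing 0ℓ 0ℓ
Poly-almostCommutativeRing = fromCommutativeRing Poly-commutativeRing 0≟ₚ_

open RingSolver Poly-almostCommutativeRing
  using (solve; Κ)
  renaming (_⊜_ to infix 4 _⊜_; _⊕_ to infixl 6 _⊕_; _⊗_ to infixl 7 _⊗_; ⊝_ to infix 8 ⊝_)

-- Gaussian binomials as polynomials: Pascal rules, symmetry, factorials.

q^-+ : ∀ i j → q^ (i + j) ≈ q^ i *ₚ q^ j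
q^-+ zero    j = ≈-sym (*ₚ-identityˡ _)
q^-+ (suc i) j = ≈-trans (∷-cong refl (q^-+ i j)) (≈-sym (0∷-*ₚ (q^ i) (q^ j)))

[]q-+ : ∀ a b → [ a + b ]q ≈ [ a ]q +ₚ q^ a *ₚ [ b ]q
[]q-+ zero    b = ≈-sym (*ₚ-identityˡ _)
[]q-+ (suc a) b =
  ≈-trans (∷-cong refl ([]q-+ a b))
          (+ₚ-cong (≈-refl {1ℤ ∷ [ a ]q}) (≈-sym (0∷-*ₚ (q^ a) [ b ]q)))

-- `gauss` is a fraction; this polynomial version, defined by one of the two q-Pascal rules, can be
-- compared with path sums without denominators.
binom : ℕ → ℕ → Poly
binom n       zero    = 1ₚ
binom zero    (suc j) = 0ₚ
binom (suc n) (suc j) = binom n j +ₚ q^ (suc j) *ₚ binom n (suc j)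

*ₚ-≈0 : ∀ p {r} → r ≈ 0ₚ → p *ₚ r ≈ 0ₚ
*ₚ-≈0 p e = ≈-trans (*ₚ-congˡ p e) (*ₚ-zeroʳ p)

binom-> : ∀ {n j} → n < j → binom n j ≈ 0ₚ
binom-> {zero}  {suc j} _         = ≈-refl
binom-> {suc n} {suc j} (s≤s n<j) =
  +ₚ-cong (binom-> n<j) (*ₚ-≈0 (q^ suc j) (binom-> (m<n⇒m<1+n n<j)))

binom-self : ∀ n → binom n n ≈ 1ₚ
binom-self zero    = ≈-refl
binom-self (suc n) =
  ≈-trans (+ₚ-cong (binom-self n) (*ₚ-≈0 (q^ suc n) (binom-> (n<1+n n)))) (+ₚ-identityʳ 1ₚ)

-- Exponents only have to be compared where the binomial does not vanish, which
-- is where the truncated subtractions below are exact.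
q^-binom : ∀ n j i i′ h → (j ≤ n → i + i′ ≡ h) →
  q^ i *ₚ q^ i′ *ₚ binom n j ≈ q^ h *ₚ binom n j
q^-binom n j i i′ h eq with j ≤? n
... | yes j≤n = *ₚ-cong (≈-trans (≈-sym (q^-+ i i′)) (≈-reflexive (cong q^_ (eq j≤n)))) ≈-refl
... | no  j≰n = ≈-trans (*ₚ-≈0 (q^ i *ₚ q^ i′) vanishes) (≈-sym (*ₚ-≈0 (q^ h) vanishes))
  where
  vanishes : binom n j ≈ 0ₚ
  vanishes = binom-> (≰⇒> j≰n)

-- The other q-Pascal rule. The defining rule splits the left side, the induction hypothesis splits
-- both parts, and the four terms regroup by the defining rule.
pascal : ∀ n j → binom (suc n) (suc j) ≈ binom n (suc j) +ₚ q^ (n ∸ j) *ₚ binom n j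
pascal zero    zero    = ∷-cong refl (0∷-≈0 ≈-refl)
pascal zero    (suc j) = ≈-trans (*ₚ-zeroʳ (q^ suc (suc j))) (≈-sym (*ₚ-zeroʳ (q^ 0)))
pascal (suc n) zero    = begin
  1ₚ +ₚ q^ 1 *ₚ binom (suc n) 1                                ≈⟨ +ₚ-cong (≈-refl {1ₚ}) (*ₚ-congˡ (q^ 1) (pascal n zero)) ⟩
  1ₚ +ₚ q^ 1 *ₚ (binom n 1 +ₚ q^ n *ₚ 1ₚ)                      ≈⟨ solve 3 (λ x b y → Κ 1ₚ ⊕ x ⊗ (b ⊕ y ⊗ Κ 1ₚ) ⊜ (Κ 1ₚ ⊕ x ⊗ b) ⊕ (x ⊗ y) ⊗ Κ 1ₚ) ≈-refl (q^ 1) (binom n 1) (q^ n) ⟩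
  1ₚ +ₚ q^ 1 *ₚ binom n 1 +ₚ q^ 1 *ₚ q^ n *ₚ 1ₚ                ≈⟨ +ₚ-cong ≈-refl (*ₚ-cong {r = 1ₚ} (≈-sym (q^-+ 1 n)) ≈-refl) ⟩
  1ₚ +ₚ q^ 1 *ₚ binom n 1 +ₚ q^ (suc n) *ₚ 1ₚ                  ∎
  where open ≈-Reasoning
pascal (suc n) (suc j) = begin
  binom (suc n) (suc j) +ₚ Q *ₚ binom (suc n) (suc (suc j))
    ≈⟨ +ₚ-cong (pascal n j) (*ₚ-congˡ Q (pascal n (suc j))) ⟩
  (B₁ +ₚ q^ (n ∸ j) *ₚ B₀) +ₚ Q *ₚ (B₂ +ₚ q^ (n ∸ suc j) *ₚ B₁)
    ≈⟨ solve 6 (λ b₀ b₁ b₂ x y z → (b₁ ⊕ x ⊗ b₀) ⊕ y ⊗ (b₂ ⊕ z ⊗ b₁) ⊜ ((b₁ ⊕ y ⊗ b₂) ⊕ x ⊗ b₀) ⊕ z ⊗ y ⊗ b₁) ≈-refl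
         B₀ B₁ B₂ (q^ (n ∸ j)) Q (q^ (n ∸ suc j)) ⟩
  ((B₁ +ₚ Q *ₚ B₂) +ₚ q^ (n ∸ j) *ₚ B₀) +ₚ q^ (n ∸ suc j) *ₚ Q *ₚ B₁
    ≈⟨ +ₚ-cong ≈-refl shift ⟩
  ((B₁ +ₚ Q *ₚ B₂) +ₚ q^ (n ∸ j) *ₚ B₀) +ₚ q^ (n ∸ j) *ₚ q^ (suc j) *ₚ B₁
    ≈⟨ solve 6 (λ b₀ b₁ b₂ x y z → ((b₁ ⊕ y ⊗ b₂) ⊕ x ⊗ b₀) ⊕ x ⊗ z ⊗ b₁ ⊜ (b₁ ⊕ y ⊗ b₂) ⊕ x ⊗ (b₀ ⊕ z ⊗ b₁)) ≈-refl
         B₀ B₁ B₂ (q^ (n ∸ j)) Q (q^ suc j) ⟩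
  (B₁ +ₚ Q *ₚ B₂) +ₚ q^ (n ∸ j) *ₚ (B₀ +ₚ q^ (suc j) *ₚ B₁)
    ∎
  where
  open ≈-Reasoning
  B₀ = binom n j
  B₁ = binom n (suc j)
  B₂ = binom n (suc (suc j))
  Q = q^ (suc (suc j))
  -- Both pairs of exponents add up to n + 1 when j < n, and otherwise `B₁` vanishes.
  shift : q^ (n ∸ suc j) *ₚ Q *ₚ B₁ ≈ q^ (n ∸ j) *ₚ q^ (suc j) *ₚ B₁
  shift = ≈-trans
    (q^-binom n (suc j) (n ∸ suc j) (suc (suc j)) (suc n)
      λ j<n → ≡.trans (+-suc (n ∸ suc j) (suc j)) (cong suc (m∸n+n≡m j<n)))
    (≈-sym (q^-binom n (suc j) (n ∸ j) (suc j) (suc n)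
      λ j<n → ≡.trans (+-suc (n ∸ j) j) (cong suc (m∸n+n≡m (<⇒≤ j<n)))))

-- The symmetry a ↔ b exchanges the two q-Pascal rules: the left side is expanded by the defining
-- rule and the right side by `pascal`.
binom-sym : ∀ a b → binom (a + b) a ≈ binom (a + b) b
binom-sym zero    b       = ≈-sym (binom-self b)
binom-sym (suc a) zero    =
  ≈-trans (≈-reflexive (cong (λ m → binom m (suc a)) (+-identityʳ (suc a)))) (binom-self (suc a))
binom-sym (suc a) (suc b) = begin
  binom (a + suc b) a +ₚ q^ suc a *ₚ binom (a + suc b) (suc a)
    ≈⟨ +ₚ-cong (binom-sym a (suc b)) (*ₚ-congˡ (q^ suc a) step₂) ⟩
  binom (a + suc b) (suc b) +ₚ q^ suc a *ₚ binom (a + suc b) b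
    ≈⟨ +ₚ-cong ≈-refl (*ₚ-cong {r = binom (a + suc b) b} (≈-reflexive (cong q^_ (≡.sym eq))) ≈-refl) ⟩
  binom (a + suc b) (suc b) +ₚ q^ (a + suc b ∸ b) *ₚ binom (a + suc b) b
    ≈⟨ pascal (a + suc b) b ⟨
  binom (suc (a + suc b)) (suc b)
    ∎
  where
  open ≈-Reasoning
  step₂ : binom (a + suc b) (suc a) ≈ binom (a + suc b) b
  step₂ rewrite +-suc a b = binom-sym (suc a) b
  eq : a + suc b ∸ b ≡ suc a
  eq rewrite +-suc a b = m+n∸n≡m (suc a) b

-- The defining rule matches the splitting [a+b+2] = [a+1] + q^(a+1) [b+1] of the last factor of the
-- factorial.
binom-factorials : ∀ a b → binom (a + b) a *ₚ ([ a ]!q *ₚ [ b ]!q) ≈ [ a + b ]!q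
binom-factorials zero    b       = ≈-trans (*ₚ-identityˡ _) (*ₚ-identityˡ _)
binom-factorials (suc a) zero    = begin
  binom (suc a + 0) (suc a) *ₚ ([ suc a ]!q *ₚ 1ₚ)  ≈⟨ *ₚ-cong (binom-sym (suc a) 0) (*ₚ-identityʳ _) ⟩
  1ₚ *ₚ [ suc a ]!q                                 ≈⟨ *ₚ-identityˡ _ ⟩
  [ suc a ]!q                                       ≡⟨ cong [_]!q (+-identityʳ (suc a)) ⟨
  [ suc a + 0 ]!q                                   ∎
  where open ≈-Reasoning
binom-factorials (suc a) (suc b) = begin
  (B₀ +ₚ Q *ₚ B₁) *ₚ (A *ₚ [ suc a ]q *ₚ (C *ₚ [ suc b ]q))
    ≈⟨ solve 7 (λ b₀ y b₁ a m c n → (b₀ ⊕ y ⊗ b₁) ⊗ (a ⊗ m ⊗ (c ⊗ n)) ⊜ (b₀ ⊗ (a ⊗ (c ⊗ n)) ⊗ m) ⊕ (b₁ ⊗ (a ⊗ m ⊗ c) ⊗ (y ⊗ n))) ≈-refl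
         B₀ Q B₁ A [ suc a ]q C [ suc b ]q ⟩
  B₀ *ₚ (A *ₚ [ suc b ]!q) *ₚ [ suc a ]q +ₚ B₁ *ₚ ([ suc a ]!q *ₚ C) *ₚ (Q *ₚ [ suc b ]q)
    ≈⟨ +ₚ-cong (*ₚ-cong {r = [ suc a ]q} (binom-factorials a (suc b)) ≈-refl) (*ₚ-cong {r = Q *ₚ [ suc b ]q} ih₂ ≈-refl) ⟩
  [ a + suc b ]!q *ₚ [ suc a ]q +ₚ [ a + suc b ]!q *ₚ (Q *ₚ [ suc b ]q)
    ≈⟨ *ₚ-distribˡ-+ₚ [ a + suc b ]!q [ suc a ]q _ ⟨
  [ a + suc b ]!q *ₚ ([ suc a ]q +ₚ Q *ₚ [ suc b ]q)
    ≈⟨ *ₚ-congˡ [ a + suc b ]!q ([]q-+ (suc a) (suc b)) ⟨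
  [ a + suc b ]!q *ₚ [ suc a + suc b ]q
    ∎
  where
  open ≈-Reasoning
  B₀ = binom (a + suc b) a
  B₁ = binom (a + suc b) (suc a)
  Q = q^ suc a
  A = [ a ]!q
  C = [ b ]!q
  ih₂ : B₁ *ₚ ([ suc a ]!q *ₚ C) ≈ [ a + suc b ]!q
  ih₂ rewrite +-suc a b = binom-factorials (suc a) b

-- Sums over all words of a given length.

sumₚ-++ : ∀ ps rs → sumₚ (ps ++ rs) ≈ sumₚ ps +ₚ sumₚ rs
sumₚ-++ []       rs = ≈-refl
sumₚ-++ (p ∷ ps) rs =
  ≈-trans (+ₚ-cong (≈-refl {p}) (sumₚ-++ ps rs)) (≈-sym (+ₚ-assoc p _ _))

-- Replacing the filter by zero summands makes every sum range over all words, so that it can be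
-- split by first or last letter.
sumₚ-filter : ∀ {A : Set} {P : A → Set} (P? : Decidable P) (f : A → Poly) xs →
  sumₚ (map f (filter P? xs)) ≈ sumₚ (map (λ x → if does (P? x) then f x else 0ₚ) xs)
sumₚ-filter P? f []       = ≈-refl
sumₚ-filter P? f (x ∷ xs) with does (P? x)
... | true  = +ₚ-cong (≈-refl {f x}) (sumₚ-filter P? f xs)
... | false = sumₚ-filter P? f xs

∑ : ∀ ℓ → (Path ℓ → Poly) → Poly
∑ ℓ f = sumₚ (map f (allPaths ℓ))

∑-cong : ∀ ℓ {f g : Path ℓ → Poly} → (∀ w → f w ≈ g w) → ∑ ℓ f ≈ ∑ ℓ g
∑-cong ℓ {f} {g} e = go (allPaths ℓ)
  where
  go : ∀ ws → sumₚ (map f ws) ≈ sumₚ (map g ws)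
  go []       = ≈-refl
  go (w ∷ ws) = +ₚ-cong (e w) (go ws)

∑-zero : ∀ ℓ {f : Path ℓ → Poly} → (∀ w → f w ≈ 0ₚ) → ∑ ℓ f ≈ 0ₚ
∑-zero ℓ {f} e = go (allPaths ℓ)
  where
  go : ∀ ws → sumₚ (map f ws) ≈ 0ₚ
  go []       = ≈-refl
  go (w ∷ ws) = +ₚ-cong (e w) (go ws)

∑-*ₚ : ∀ ℓ p (f : Path ℓ → Poly) → ∑ ℓ (λ w → p *ₚ f w) ≈ p *ₚ ∑ ℓ f
∑-*ₚ ℓ p f = go (allPaths ℓ)
  where
  go : ∀ ws → sumₚ (map (λ w → p *ₚ f w) ws) ≈ p *ₚ sumₚ (map f ws)
  go []       = ≈-sym (*ₚ-zeroʳ p)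
  go (w ∷ ws) = ≈-trans (+ₚ-cong ≈-refl (go ws)) (≈-sym (*ₚ-distribˡ-+ₚ p (f w) _))

∑-∷ : ∀ ℓ (f : Path (suc ℓ) → Poly) → ∑ (suc ℓ) f ≈ ∑ ℓ (f ∘ (up ∷_)) +ₚ ∑ ℓ (f ∘ (down ∷_))
∑-∷ ℓ f = begin
  sumₚ (map f (map (up ∷_) ws ++ map (down ∷_) ws))
    ≡⟨ cong sumₚ (map-++ f (map (up ∷_) ws) _) ⟩
  sumₚ (map f (map (up ∷_) ws) ++ map f (map (down ∷_) ws))
    ≈⟨ sumₚ-++ (map f (map (up ∷_) ws)) _ ⟩
  sumₚ (map f (map (up ∷_) ws)) +ₚ sumₚ (map f (map (down ∷_) ws))
    ≡⟨ cong₂ (λ us ds → sumₚ us +ₚ sumₚ ds) (map-∘ ws) (map-∘ ws) ⟨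
  ∑ ℓ (f ∘ (up ∷_)) +ₚ ∑ ℓ (f ∘ (down ∷_))
    ∎
  where
  open ≈-Reasoning
  ws = allPaths ℓ

-- `allPaths` branches on the first letter, whereas the recurrences remove the last one. Splitting
-- at both ends gives four sums, and the middle two change places.
∑-∷ʳ : ∀ ℓ (f : Path (suc ℓ) → Poly) → ∑ (suc ℓ) f ≈ ∑ ℓ (f ∘ (_∷ʳ up)) +ₚ ∑ ℓ (f ∘ (_∷ʳ down))
∑-∷ʳ zero    f = ≈-sym (+ₚ-assoc (f (up ∷ [])) 0ₚ _)
∑-∷ʳ (suc ℓ) f = begin
  ∑ (suc (suc ℓ)) f
    ≈⟨ ∑-∷ (suc ℓ) f ⟩
  ∑ (suc ℓ) (f ∘ (up ∷_)) +ₚ ∑ (suc ℓ) (f ∘ (down ∷_))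
    ≈⟨ +ₚ-cong (∑-∷ʳ ℓ (f ∘ (up ∷_))) (∑-∷ʳ ℓ (f ∘ (down ∷_))) ⟩
  (uu +ₚ ud) +ₚ (du +ₚ dd)
    ≈⟨ +ₚ-interchange uu ud du dd ⟩
  (uu +ₚ du) +ₚ (ud +ₚ dd)
    ≈⟨ +ₚ-cong (∑-∷ ℓ (f ∘ (_∷ʳ up))) (∑-∷ ℓ (f ∘ (_∷ʳ down))) ⟨
  ∑ (suc ℓ) (f ∘ (_∷ʳ up)) +ₚ ∑ (suc ℓ) (f ∘ (_∷ʳ down))
    ∎
  where
  open ≈-Reasoning
  uu = ∑ ℓ (λ w → f (up ∷ (w ∷ʳ up)))
  ud = ∑ ℓ (λ w → f (up ∷ (w ∷ʳ down)))
  du = ∑ ℓ (λ w → f (down ∷ (w ∷ʳ up)))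
  dd = ∑ ℓ (λ w → f (down ∷ (w ∷ʳ down)))

-- Paths above a floor as partial runs of a counter.

-- The state m is the distance to the floor; nothing means that a step went below it.
move : Fin 2 → ℕ → Maybe ℕ
move up   m       = just (suc m)
move down zero    = nothing
move down (suc m) = just m

run : ∀ {ℓ} → ℕ → Path ℓ → Maybe ℕ
run m []      = just m
run m (s ∷ π) = move s m >>= λ m′ → run m′ π

run-∷ʳ : ∀ {ℓ} m (π : Path ℓ) s → run m (π ∷ʳ s) ≡ (run m π >>= move s)
run-∷ʳ m       []         up   = refl
run-∷ʳ zero    []         down = refl
run-∷ʳ (suc m) []         down = refl
run-∷ʳ m       (up ∷ π)   s    = run-∷ʳ (suc m) π s
run-∷ʳ zero    (down ∷ π) s    = refl
run-∷ʳ (suc m) (down ∷ π) s    = run-∷ʳ m π s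

move-up-height : ∀ h m → (1ℤ ℤ.+ h) ℤ.+ + m ≡ h ℤ.+ + suc m
move-up-height h m = lemma h (+ m)
  where
  lemma : ∀ h m → (1ℤ ℤ.+ h) ℤ.+ m ≡ h ℤ.+ (1ℤ ℤ.+ m)
  lemma = solve-∀

move-down-height : ∀ h m → (-1ℤ ℤ.+ h) ℤ.+ + suc m ≡ h ℤ.+ + m
move-down-height h m = lemma h (+ m)
  where
  lemma : ∀ h m → (-1ℤ ℤ.+ h) ℤ.+ (1ℤ ℤ.+ m) ≡ h ℤ.+ m
  lemma = solve-∀

-- The geometric condition after translating the path up by m, so that the floor becomes the line of
-- height 0.
Survives : ∀ {ℓ} → ℕ → ℕ → Path ℓ → Set
Survives {ℓ} m e π = height π (fromℕ ℓ) ℤ.+ + m ≡ + e × (∀ i → 0ℤ ℤ.≤ height π i ℤ.+ + m)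

survives⇒run : ∀ {ℓ} m {e} (π : Path ℓ) → Survives m e π → run m π ≡ just e
survives⇒run m       []         (h≡ , _)   = cong just (ℤ.+-injective (≡.trans (≡.sym (ℤ.+-identityˡ (+ m))) h≡))
survives⇒run m       (up ∷ π)   (h≡ , h≥)  = survives⇒run (suc m) π
  ( ≡.trans (≡.sym (move-up-height (height π (fromℕ _)) m)) h≡
  , λ i → subst (0ℤ ℤ.≤_) (move-up-height (height π i) m) (h≥ (suc i)) )
survives⇒run zero    (down ∷ π) (h≡ , h≥) with h≥ (suc zero)
... | ()
survives⇒run (suc m) (down ∷ π) (h≡ , h≥) = survives⇒run m π
  ( ≡.trans (≡.sym (move-down-height (height π (fromℕ _)) m)) h≡
  , λ i → subst (0ℤ ℤ.≤_) (move-down-height (height π i) m) (h≥ (suc i)) )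

run⇒survives : ∀ {ℓ} m {e} (π : Path ℓ) → run m π ≡ just e → Survives m e π
run⇒survives m       []         refl = ℤ.+-identityˡ (+ m) , λ { zero → ℤ.+≤+ z≤n }
run⇒survives m       (up ∷ π)   eq with run⇒survives (suc m) π eq
... | h≡ , h≥ = ≡.trans (move-up-height (height π (fromℕ _)) m) h≡
  , λ { zero → ℤ.+≤+ z≤n ; (suc i) → subst (0ℤ ℤ.≤_) (≡.sym (move-up-height (height π i) m)) (h≥ i) }
run⇒survives (suc m) (down ∷ π) eq with run⇒survives m π eq
... | h≡ , h≥ = ≡.trans (move-down-height (height π (fromℕ _)) m) h≡
  , λ { zero → ℤ.+≤+ z≤n ; (suc i) → subst (0ℤ ℤ.≤_) (≡.sym (move-down-height (height π i) m)) (h≥ i) }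

bottom-suc : ∀ r → bottom (suc r) ≡ ℤ.- + (2 * r)
bottom-suc r = ≡.trans (cong (λ c → ℤ.- + c ℤ.+ + 2) (eq r)) (lemma (+ (2 * r)))
  where
  eq : ∀ r → 2 * suc r ≡ 2 + 2 * r
  eq = solveℕ-∀
  lemma : ∀ c → ℤ.- (+ 2 ℤ.+ c) ℤ.+ + 2 ≡ ℤ.- c
  lemma = solve-∀

-- The floor for `suc r` is the line y = -2r, so the path starts 2r above it, and the initial up
-- step leaves `w` to start at distance 2r + 1.
In𝓑⇔run : ∀ n r w → In𝓑 (suc n) (suc r) (up ∷ w) ⇔ (run (suc (2 * r)) w ≡ just 0)
In𝓑⇔run n r w = mk⇔ to from
  where
  m = 2 * r
  π : Path (2 * suc n)
  π = up ∷ w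
  to : In𝓑 (suc n) (suc r) π → run (suc m) w ≡ just 0
  to (_ , h≡ , h≥) = survives⇒run m π
    ( ≡.trans (cong (ℤ._+ + m) (≡.trans h≡ (bottom-suc r))) (ℤ.+-inverseˡ (+ m))
    , λ i → subst (ℤ._≤ height π i ℤ.+ + m) (ℤ.+-inverseˡ (+ m))
              (ℤ.+-monoˡ-≤ (+ m) (subst (ℤ._≤ height π i) (bottom-suc r) (h≥ i))) )
  cancel : ∀ h c → h ℤ.+ c ℤ.+ ℤ.- c ≡ h
  cancel = solve-∀
  from : run (suc m) w ≡ just 0 → In𝓑 (suc n) (suc r) π
  from eq with run⇒survives m π eq
  ... | h≡ , h≥ = refl
    , (begin
        height π (fromℕ (2 * suc n))                        ≡⟨ cancel _ (+ m) ⟨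
        height π (fromℕ (2 * suc n)) ℤ.+ + m ℤ.+ ℤ.- + m    ≡⟨ cong (ℤ._+ ℤ.- + m) h≡ ⟩
        0ℤ ℤ.+ ℤ.- + m                                      ≡⟨ ℤ.+-identityˡ _ ⟩
        ℤ.- + m                                             ≡⟨ bottom-suc r ⟨
        bottom (suc r)                                      ∎)
    , λ i → ≡.subst₂ ℤ._≤_ (≡.trans (ℤ.+-identityˡ _) (≡.sym (bottom-suc r))) (cancel (height π i) (+ m))
              (ℤ.+-monoˡ-≤ (ℤ.- + m) (h≥ i))
    where open ≡.≡-Reasoning

-- The major index under changes at either end of a word.

descent : ℕ → Fin 2 → Fin 2 → ℕ
descent i s t = if does (t Fin.<? s) then i else 0

sum-descentsFrom : ∀ {ℓ} i s t (π : Path ℓ) →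
  sum (descentsFrom i (s ∷ t ∷ π)) ≡ descent i s t + sum (descentsFrom (suc i) (t ∷ π))
sum-descentsFrom i s t π with does (t Fin.<? s)
... | true  = refl
... | false = refl

-- The only new adjacent pair is (s, t), and `s` stands at position ℓ + i because ℓ letters precede
-- it and the first position is i.
sum-descentsFrom-∷ʳ : ∀ {ℓ} i (π : Path ℓ) s t →
  sum (descentsFrom i (π ∷ʳ s ∷ʳ t)) ≡ descent (ℓ + i) s t + sum (descentsFrom i (π ∷ʳ s))
sum-descentsFrom-∷ʳ i [] s t = sum-descentsFrom i s t []
sum-descentsFrom-∷ʳ {suc ℓ} i (x ∷ π) s t = begin
  sum (descentsFrom i (x ∷ (π ∷ʳ s ∷ʳ t)))                                       ≡⟨ peel (π ∷ʳ s) t ⟩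
  descent i x (first (π ∷ʳ s)) + sum (descentsFrom (suc i) (π ∷ʳ s ∷ʳ t))        ≡⟨ cong (λ c → d + c) (sum-descentsFrom-∷ʳ (suc i) π s t) ⟩
  d + (descent (ℓ + suc i) s t + sum (descentsFrom (suc i) (π ∷ʳ s)))            ≡⟨ shuffle d (descent (ℓ + suc i) s t) _ ⟩
  descent (ℓ + suc i) s t + (d + sum (descentsFrom (suc i) (π ∷ʳ s)))            ≡⟨ cong₂ (λ j c → descent j s t + c) (+-suc ℓ i) (≡.sym (peel₀ (π ∷ʳ s))) ⟩
  descent (suc ℓ + i) s t + sum (descentsFrom i (x ∷ (π ∷ʳ s)))                  ∎
  where
  open ≡.≡-Reasoning
  -- `descentsFrom` computes only once its second letter is visible. Naming that letter by `first`
  -- avoids a case split on π.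
  first : ∀ {ℓ} → Path (suc ℓ) → Fin 2
  first (y ∷ _) = y
  d = descent i x (first (π ∷ʳ s))
  peel₀ : ∀ {ℓ} (ρ : Path (suc ℓ)) →
    sum (descentsFrom i (x ∷ ρ)) ≡ descent i x (first ρ) + sum (descentsFrom (suc i) ρ)
  peel₀ (y ∷ ρ) = sum-descentsFrom i x y ρ
  peel : ∀ {ℓ} (ρ : Path (suc ℓ)) t →
    sum (descentsFrom i (x ∷ (ρ ∷ʳ t))) ≡ descent i x (first ρ) + sum (descentsFrom (suc i) (ρ ∷ʳ t))
  peel (y ∷ ρ) t = sum-descentsFrom i x y (ρ ∷ʳ t)
  shuffle : ∀ a b c → a + (b + c) ≡ b + (a + c)
  shuffle = solveℕ-∀

-- `down` is the larger letter, so appending it never creates a descent.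
maj-∷ʳdown : ∀ {ℓ} (π : Path ℓ) → maj (π ∷ʳ down) ≡ maj π
maj-∷ʳdown {zero}  []  = refl
maj-∷ʳdown {suc ℓ} π with initLast π
... | ρ , up   , refl = sum-descentsFrom-∷ʳ 1 ρ up down
... | ρ , down , refl = sum-descentsFrom-∷ʳ 1 ρ down down

maj-∷ʳup∷ʳup : ∀ {ℓ} (π : Path ℓ) → maj (π ∷ʳ up ∷ʳ up) ≡ maj (π ∷ʳ up)
maj-∷ʳup∷ʳup π = sum-descentsFrom-∷ʳ 1 π up up

maj-∷ʳdown∷ʳup : ∀ {ℓ} (π : Path ℓ) → maj (π ∷ʳ down ∷ʳ up) ≡ suc ℓ + maj π
maj-∷ʳdown∷ʳup {ℓ} π =
  ≡.trans (sum-descentsFrom-∷ʳ 1 π down up) (cong₂ _+_ (+-comm ℓ 1) (maj-∷ʳdown π))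

-- Shifting a word by one position raises each descent position by one, hence the sum by the number
-- of descents, which the subtraction takes off again.
sum-descentsFrom-suc : ∀ {ℓ} i (π : Path ℓ) →
  sum (descentsFrom (suc i) π) ∸ length (descentsFrom (suc i) π) ≡ sum (descentsFrom i π)
sum-descentsFrom-suc i π =
  ≡.trans (cong (_∸ length (descentsFrom (suc i) π)) (shift i π))
          (m+n∸n≡m (sum (descentsFrom i π)) (length (descentsFrom (suc i) π)))
  where
  shift : ∀ {ℓ} i (π : Path ℓ) →
    sum (descentsFrom (suc i) π) ≡ sum (descentsFrom i π) + length (descentsFrom (suc i) π)
  shift i []          = refl
  shift i (s ∷ [])    = refl
  shift i (s ∷ t ∷ π) with does (t Fin.<? s) | shift (suc i) (t ∷ π)
  ... | false | eq = eq
  ... | true  | eq = ≡.trans (cong (λ c → suc i + c) eq) (shuffle i _ _)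
    where
    shuffle : ∀ a b c → suc a + (b + c) ≡ a + b + suc c
    shuffle = solveℕ-∀

-- An initial up step creates no descent but shifts all others by one. The cases on π only let
-- `descentsFrom` compute.
maj∸des-up∷ : ∀ {ℓ} (π : Path ℓ) → maj (up ∷ π) ∸ des (up ∷ π) ≡ maj π
maj∸des-up∷ []         = refl
maj∸des-up∷ (up ∷ π)   = sum-descentsFrom-suc 1 (up ∷ π)
maj∸des-up∷ (down ∷ π) = sum-descentsFrom-suc 1 (down ∷ π)

-- The maj-generating functions T and U and their recurrences.

infix 4 _≟ᴹ_
_≟ᴹ_ : (x y : Maybe ℕ) → Dec (x ≡ y)
_≟ᴹ_ = ≡-decMaybe _≟_

[_ends_]_ : Maybe ℕ → ℕ → Poly → Poly
[ m ends e ] p = if does (m ≟ᴹ just e) then p else 0ₚ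

ends-up : ∀ m e p → [ m >>= move up ends suc e ] p ≡ [ m ends e ] p
ends-up nothing  e p = refl
ends-up (just m) e p = refl

ends-up-0 : ∀ m p → [ m >>= move up ends 0 ] p ≡ 0ₚ
ends-up-0 nothing  p = refl
ends-up-0 (just m) p = refl

ends-down : ∀ m e p → [ m >>= move down ends e ] p ≡ [ m ends suc e ] p
ends-down nothing        e p = refl
ends-down (just zero)    e p = refl
ends-down (just (suc m)) e p = refl

ends-*ₚ : ∀ m e p r → [ m ends e ] (p *ₚ r) ≈ p *ₚ [ m ends e ] r
ends-*ₚ m e p r with does (m ≟ᴹ just e)
... | true  = ≈-refl
... | false = ≈-sym (*ₚ-zeroʳ p)

module _ (k : ℕ) where

  weight : ∀ {ℓ} → ℕ → Path ℓ → Poly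
  weight e π = [ run k π ends e ] (q^ maj π)

  -- These are T and U for the starting distance k; the words behind `totalUp ℓ e` have ℓ + 1
  -- letters.
  total totalUp : ℕ → ℕ → Poly
  total   ℓ e = ∑ ℓ (weight e)
  totalUp ℓ e = ∑ ℓ (λ π → weight e (π ∷ʳ up))

  weight-∷ʳdown : ∀ {ℓ} e (π : Path ℓ) → weight e (π ∷ʳ down) ≡ weight (suc e) π
  weight-∷ʳdown e π rewrite run-∷ʳ k π down | maj-∷ʳdown π = ends-down (run k π) e _

  weight-∷ʳup-0 : ∀ {ℓ} (π : Path ℓ) → weight 0 (π ∷ʳ up) ≡ 0ₚ
  weight-∷ʳup-0 π rewrite run-∷ʳ k π up = ends-up-0 (run k π) _

  weight-∷ʳup∷ʳup : ∀ {ℓ} e (π : Path ℓ) → weight (suc e) (π ∷ʳ up ∷ʳ up) ≡ weight e (π ∷ʳ up)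
  weight-∷ʳup∷ʳup e π rewrite run-∷ʳ k (π ∷ʳ up) up | maj-∷ʳup∷ʳup π = ends-up (run k (π ∷ʳ up)) e _

  -- The valley returns to the distance at which π ended and adds one descent, at position ℓ + 1.
  weight-∷ʳdown∷ʳup : ∀ {ℓ} e (π : Path ℓ) →
    weight (suc e) (π ∷ʳ down ∷ʳ up) ≈ q^ suc ℓ *ₚ weight (suc e) π
  weight-∷ʳdown∷ʳup {ℓ} e π
    rewrite run-∷ʳ k (π ∷ʳ down) up | maj-∷ʳdown∷ʳup π | ends-up (run k (π ∷ʳ down)) e (q^ (suc ℓ + maj π))
          | run-∷ʳ k π down | ends-down (run k π) e (q^ (suc ℓ + maj π)) =
    ≈-trans (ends-cong (run k π)) (ends-*ₚ (run k π) (suc e) (q^ suc ℓ) (q^ maj π))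
    where
    ends-cong : ∀ m → [ m ends suc e ] (q^ (suc ℓ + maj π)) ≈ [ m ends suc e ] (q^ suc ℓ *ₚ q^ maj π)
    ends-cong m with does (m ≟ᴹ just (suc e))
    ... | true  = q^-+ (suc ℓ) (maj π)
    ... | false = ≈-refl

  total-suc : ∀ ℓ e → total (suc ℓ) e ≈ totalUp ℓ e +ₚ total ℓ (suc e)
  total-suc ℓ e = ≈-trans (∑-∷ʳ ℓ (weight e))
    (+ₚ-cong (≈-refl {totalUp ℓ e}) (∑-cong ℓ λ π → ≈-reflexive (weight-∷ʳdown e π)))

  -- After an up step the distance to the floor is at least 1.
  totalUp-0 : ∀ ℓ → totalUp ℓ 0 ≈ 0ₚ
  totalUp-0 ℓ = ∑-zero ℓ λ π → ≈-reflexive (weight-∷ʳup-0 π)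

  -- Split by the letter before the final up step: an up leaves `maj` as it is, a down gives the
  -- factor q^(ℓ+1).
  totalUp-suc : ∀ ℓ e → totalUp (suc ℓ) (suc e) ≈ totalUp ℓ e +ₚ q^ suc ℓ *ₚ total ℓ (suc e)
  totalUp-suc ℓ e = ≈-trans (∑-∷ʳ ℓ (λ π → weight (suc e) (π ∷ʳ up)))
    (+ₚ-cong (∑-cong ℓ λ π → ≈-reflexive (weight-∷ʳup∷ʳup e π))
             (≈-trans (∑-cong ℓ (weight-∷ʳdown∷ʳup e)) (∑-*ₚ ℓ (q^ suc ℓ) (weight (suc e)))))

majDesSum≈total : ∀ n r →
  majDesSum (suc n) (suc r) ≈ total (suc (2 * r)) (2 * suc n ∸ 1) 0
majDesSum≈total n r = begin
  majDesSum (suc n) (suc r)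
    ≈⟨ sumₚ-filter (in𝓑? (suc n) (suc r)) f (allPaths (2 * suc n)) ⟩
  ∑ (suc ℓ) g
    ≈⟨ ∑-∷ ℓ g ⟩
  ∑ ℓ (g ∘ (up ∷_)) +ₚ ∑ ℓ (g ∘ (down ∷_))
    -- On an initial down step the membership test computes to false, so the second half of the sum
    -- vanishes.
    ≈⟨ +ₚ-cong (∑-cong ℓ goodStart) (∑-zero ℓ λ _ → ≈-refl) ⟩
  total k ℓ 0 +ₚ 0ₚ
    ≈⟨ +ₚ-identityʳ _ ⟩
  total k ℓ 0
    ∎
  where
  open ≈-Reasoning
  ℓ = 2 * suc n ∸ 1
  k = suc (2 * r)
  f g : Path (2 * suc n) → Poly
  f π = q^ (maj π ∸ des π)
  g π = if does (in𝓑? (suc n) (suc r) π) then f π else 0ₚ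
  goodStart : ∀ w → g (up ∷ w) ≈ weight k 0 w
  goodStart w
    rewrite does-⇔ (In𝓑⇔run n r w) (in𝓑? (suc n) (suc r) (up ∷ w)) (run k w ≟ᴹ just 0)
          | maj∸des-up∷ w = ≈-refl

-- Closed forms of T and U.

≈0-diff : ∀ p {r s} → r ≈ 0ₚ → s ≈ 0ₚ → r -ₚ p *ₚ s ≈ 0ₚ
≈0-diff p r≈0 s≈0 = +ₚ-cong r≈0 (-ₚ-cong (*ₚ-≈0 p s≈0))

module _ (k : ℕ) where

  total-0-self : total k 0 k ≈ 1ₚ
  total-0-self rewrite dec-true (just k ≟ᴹ just k) refl = ≈-refl

  total-0-≢ : ∀ {e} → k ≢ e → total k 0 e ≈ 0ₚ
  total-0-≢ {e} k≢e rewrite dec-false (just k ≟ᴹ just e) (λ eq → k≢e (just-injective eq)) = ≈-refl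

  -- A step lowers the distance by at most one, so ℓ letters end no lower than k - ℓ; a further
  -- final up step gives k - ℓ + 1, hence the weaker `≤` for `totalUp`. These bounds serve the case
  -- of no ups below, where the closed form of U would need a = -1.
  total-unreachable : ∀ ℓ e → ℓ + e < k → total k ℓ e ≈ 0ₚ
  totalUp-unreachable : ∀ ℓ e → ℓ + e ≤ k → totalUp k ℓ e ≈ 0ₚ

  total-unreachable zero    e e<k = total-0-≢ (λ k≡e → <⇒≢ e<k (≡.sym k≡e))
  total-unreachable (suc ℓ) e lt  = ≈-trans (total-suc k ℓ e)
    (+ₚ-cong (totalUp-unreachable ℓ e (<⇒≤ (<⇒≤ lt)))
             (total-unreachable ℓ (suc e) (subst (_< k) (≡.sym (+-suc ℓ e)) lt)))

  totalUp-unreachable ℓ       zero    le = totalUp-0 k ℓ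
  -- A lone up step ending at distance e + 1 has by computation the weight of the empty word ending
  -- at e.
  totalUp-unreachable zero    (suc e) le = total-unreachable zero e le
  totalUp-unreachable (suc ℓ) (suc e) le = ≈-trans (totalUp-suc k ℓ e)
    (+ₚ-cong (totalUp-unreachable ℓ e (<⇒≤ (<⇒≤ le′)))
             (*ₚ-≈0 (q^ suc ℓ) (total-unreachable ℓ (suc e) (subst (_< k) (≡.sym (+-suc ℓ e)) le′))))
    where
    le′ : suc (suc (ℓ + e)) ≤ k
    le′ = subst (_≤ k) (cong suc (+-suc ℓ e)) le

  -- At q = 1 the subtracted binomial is the reflection principle: it counts the words with a ups
  -- that sink below the floor.
  closedTotal closedUp : ℕ → ℕ → Poly
  closedTotal ℓ a = binom ℓ a -ₚ q^ suc k *ₚ binom ℓ (suc k + a)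
  closedUp    ℓ a = q^ (ℓ ∸ a) *ₚ (binom ℓ a -ₚ binom ℓ (suc k + a))

  binom-shift-suc : ∀ ℓ a → binom (suc ℓ) (suc k + suc a) ≈
    binom ℓ (suc k + suc a) +ₚ q^ (ℓ ∸ (suc k + a)) *ₚ binom ℓ (suc k + a)
  binom-shift-suc ℓ a =
    subst (λ j → binom (suc ℓ) (suc k + suc a) ≈ binom ℓ (suc k + suc a) +ₚ q^ (ℓ ∸ j) *ₚ binom ℓ j)
          (+-suc k a) (pascal ℓ (k + suc a))

  -- `pascal` is applied to both binomials. The powers of q agree because (ℓ - (k+1+a)) + (k+1) = ℓ
  -- - a wherever the reflected binomial is nonzero.
  closedTotal-suc : ∀ ℓ a → closedUp ℓ a +ₚ closedTotal ℓ (suc a) ≈ closedTotal (suc ℓ) (suc a)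
  closedTotal-suc ℓ a = begin
    x *ₚ (b₀ -ₚ c₀) +ₚ (b₁ -ₚ y *ₚ c₁)
      ≈⟨ solve 6 (λ x y b₀ b₁ c₀ c₁ → x ⊗ (b₀ ⊕ ⊝ c₀) ⊕ (b₁ ⊕ ⊝ (y ⊗ c₁)) ⊜ (b₁ ⊕ x ⊗ b₀) ⊕ ⊝ (y ⊗ c₁ ⊕ x ⊗ c₀)) ≈-refl
           x y b₀ b₁ c₀ c₁ ⟩
    (b₁ +ₚ x *ₚ b₀) -ₚ (y *ₚ c₁ +ₚ x *ₚ c₀)
      ≈⟨ +ₚ-cong (pascal ℓ a) (-ₚ-cong (+ₚ-cong (≈-refl {y *ₚ c₁}) absorb)) ⟨
    binom (suc ℓ) (suc a) -ₚ (y *ₚ c₁ +ₚ z *ₚ y *ₚ c₀)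
      ≈⟨ solve 5 (λ y z p c₀ c₁ → p ⊕ ⊝ (y ⊗ c₁ ⊕ z ⊗ y ⊗ c₀) ⊜ p ⊕ ⊝ (y ⊗ (c₁ ⊕ z ⊗ c₀))) ≈-refl
           y z (binom (suc ℓ) (suc a)) c₀ c₁ ⟩
    binom (suc ℓ) (suc a) -ₚ y *ₚ (c₁ +ₚ z *ₚ c₀)
      ≈⟨ +ₚ-cong (≈-refl {binom (suc ℓ) (suc a)}) (-ₚ-cong (*ₚ-congˡ y (binom-shift-suc ℓ a))) ⟨
    closedTotal (suc ℓ) (suc a)
      ∎
    where
    open ≈-Reasoning
    x = q^ (ℓ ∸ a)
    y = q^ suc k
    z = q^ (ℓ ∸ (suc k + a))
    b₀ = binom ℓ a
    b₁ = binom ℓ (suc a)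
    c₀ = binom ℓ (suc k + a)
    c₁ = binom ℓ (suc k + suc a)
    exponent : suc k + a ≤ ℓ → ℓ ∸ (suc k + a) + suc k ≡ ℓ ∸ a
    exponent le = ≡.trans (≡.sym (m+n∸n≡m (d + suc k) a))
      (cong (_∸ a) (≡.trans (+-assoc d (suc k) a) (m∸n+n≡m le)))
      where d = ℓ ∸ (suc k + a)
    absorb : z *ₚ y *ₚ c₀ ≈ x *ₚ c₀
    absorb = q^-binom ℓ (suc k + a) (ℓ ∸ (suc k + a)) (suc k) (ℓ ∸ a) exponent

  -- Writing q^(ℓ+1) as q^(ℓ-a) q^(a+1) brings out the common factor q^(ℓ-a); what remains is the
  -- defining Pascal rule for both binomials.
  closedUp-suc : ∀ ℓ a →
    closedUp ℓ a +ₚ q^ suc ℓ *ₚ closedTotal ℓ (suc a) ≈ closedUp (suc ℓ) (suc a)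
  closedUp-suc ℓ a = begin
    x *ₚ (b₀ -ₚ c₀) +ₚ w *ₚ (b₁ -ₚ y *ₚ c₁)
      ≈⟨ solve 7 (λ x y w b₀ b₁ c₀ c₁ → x ⊗ (b₀ ⊕ ⊝ c₀) ⊕ w ⊗ (b₁ ⊕ ⊝ (y ⊗ c₁)) ⊜ x ⊗ (b₀ ⊕ ⊝ c₀) ⊕ (w ⊗ b₁ ⊕ ⊝ (y ⊗ (w ⊗ c₁)))) ≈-refl
           x y w b₀ b₁ c₀ c₁ ⟩
    x *ₚ (b₀ -ₚ c₀) +ₚ (w *ₚ b₁ -ₚ y *ₚ (w *ₚ c₁))
      ≈⟨ +ₚ-cong (≈-refl {x *ₚ (b₀ -ₚ c₀)})
           (+ₚ-cong (absorb (suc a) (n<1+n a)) (-ₚ-cong (*ₚ-congˡ y (absorb (suc k + suc a) (m≤n+m (suc a) (suc k)))))) ⟨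
    x *ₚ (b₀ -ₚ c₀) +ₚ (x *ₚ v *ₚ b₁ -ₚ y *ₚ (x *ₚ v *ₚ c₁))
      ≈⟨ solve 7 (λ x y v b₀ b₁ c₀ c₁ → x ⊗ (b₀ ⊕ ⊝ c₀) ⊕ (x ⊗ v ⊗ b₁ ⊕ ⊝ (y ⊗ (x ⊗ v ⊗ c₁))) ⊜ x ⊗ ((b₀ ⊕ v ⊗ b₁) ⊕ ⊝ (c₀ ⊕ y ⊗ v ⊗ c₁))) ≈-refl
           x y v b₀ b₁ c₀ c₁ ⟩
    x *ₚ ((b₀ +ₚ v *ₚ b₁) -ₚ (c₀ +ₚ y *ₚ v *ₚ c₁))
      ≈⟨ *ₚ-congˡ x (+ₚ-cong (≈-refl {b₀ +ₚ v *ₚ b₁}) (-ₚ-cong (+ₚ-cong c₀-index (*ₚ-cong {r = c₁} (≈-sym (q^-+ (suc k) (suc a))) ≈-refl)))) ⟩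
    closedUp (suc ℓ) (suc a)
      ∎
    where
    open ≈-Reasoning
    x = q^ (ℓ ∸ a)
    y = q^ suc k
    v = q^ suc a
    w = q^ suc ℓ
    b₀ = binom ℓ a
    b₁ = binom ℓ (suc a)
    c₀ = binom ℓ (suc k + a)
    c₁ = binom ℓ (suc k + suc a)
    c₀-index : c₀ ≈ binom ℓ (k + suc a)
    c₀-index = ≈-reflexive (cong (binom ℓ) (≡.sym (+-suc k a)))
    absorb : ∀ j → a < j → x *ₚ v *ₚ binom ℓ j ≈ w *ₚ binom ℓ j
    absorb j a<j = q^-binom ℓ j (ℓ ∸ a) (suc a) (suc ℓ)
      λ j≤ℓ → ≡.trans (+-suc (ℓ ∸ a) a) (cong suc (m∸n+n≡m (<⇒≤ (≤-trans a<j j≤ℓ))))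

  binom-k+0 : ∀ {ℓ} → ℓ < suc k → binom ℓ (suc k + 0) ≈ 0ₚ
  binom-k+0 {ℓ} lt = binom-> (subst (ℓ <_) (≡.sym (+-identityʳ (suc k))) lt)

  -- The equations fix a as the number of ups: a ups and ℓ - a downs lead from k to e, with one more
  -- up for `totalUp`. Simultaneous induction on ℓ along the recurrences.
  total-closed : ∀ ℓ a e → a + a + k ≡ ℓ + e → total k ℓ e ≈ closedTotal ℓ a
  totalUp-closed : ∀ ℓ a e → suc (a + a + k) ≡ ℓ + e → totalUp k ℓ e ≈ closedUp ℓ a

  total-closed zero zero e refl =
    ≈-trans total-0-self (≈-sym (+ₚ-cong (≈-refl {1ₚ}) (-ₚ-cong (*ₚ-zeroʳ (q^ suc k)))))
  -- An empty word has no ups: here the equation forces e > k, and both binomials vanish.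
  total-closed zero (suc a) e eq =
    ≈-trans (total-0-≢ (<⇒≢ (subst (k <_) eq (s≤s (m≤n+m k (a + suc a))))))
            (≈-sym (≈0-diff (q^ suc k) ≈-refl ≈-refl))
  -- Without ups the U-term is unreachable, and the reflected binomials vanish because the length ℓ
  -- + 1 is at most k.
  total-closed (suc ℓ) zero e eq = begin
    total k (suc ℓ) e                      ≈⟨ total-suc k ℓ e ⟩
    totalUp k ℓ e +ₚ total k ℓ (suc e)     ≈⟨ +ₚ-cong (totalUp-unreachable ℓ e (<⇒≤ ℓ+e<k))
                                                (total-closed ℓ zero (suc e) (≡.trans eq (≡.sym (+-suc ℓ e)))) ⟩
    closedTotal ℓ 0                        ≈⟨ +ₚ-cong (≈-refl {1ₚ}) (-ₚ-cong (*ₚ-congˡ (q^ suc k)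
                                                (≈-trans (binom-k+0 (<⇒≤ ℓ<k)) (≈-sym (binom-k+0 ℓ<k))))) ⟩
    closedTotal (suc ℓ) 0                  ∎
    where
    open ≈-Reasoning
    ℓ+e<k : ℓ + e < k
    ℓ+e<k = ≤-reflexive (≡.sym eq)
    ℓ<k : suc ℓ < suc k
    ℓ<k = s≤s (≤-trans (s≤s (m≤m+n ℓ e)) ℓ+e<k)
  total-closed (suc ℓ) (suc a) e eq =
    ≈-trans (total-suc k ℓ e)
      (≈-trans (+ₚ-cong (totalUp-closed ℓ a e eq′)
                        (total-closed ℓ (suc a) (suc e) (≡.trans eq (≡.sym (+-suc ℓ e)))))
               (closedTotal-suc ℓ a))
    where
    eq′ : suc (a + a + k) ≡ ℓ + e
    eq′ = suc-injective (≡.trans (cong (λ c → suc (c + k)) (≡.sym (+-suc a a))) eq)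

  totalUp-closed zero zero (suc e) refl = begin
    total k 0 k               ≈⟨ total-0-self ⟩
    1ₚ                        ≈⟨ *ₚ-identityˡ 1ₚ ⟨
    1ₚ *ₚ (1ₚ -ₚ 0ₚ)          ∎
    where open ≈-Reasoning
  totalUp-closed zero (suc a) (suc e) eq =
    ≈-trans (total-0-≢ (<⇒≢ (subst (k <_) (suc-injective eq) (s≤s (m≤n+m k (a + suc a))))))
            (≈-sym (*ₚ-zeroʳ 1ₚ))
  -- At e = 0 the equation reads a + (k+1+a) = ℓ + 1, so the two binomials in `closedUp` are mirror
  -- images and cancel.
  totalUp-closed (suc ℓ) a zero eq = begin
    totalUp k (suc ℓ) 0                               ≈⟨ totalUp-0 k (suc ℓ) ⟩
    0ₚ                                                ≈⟨ *ₚ-≈0 x (-ₚ-inverseʳ (binom (suc ℓ) a)) ⟨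
    x *ₚ (binom (suc ℓ) a -ₚ binom (suc ℓ) a)         ≈⟨ *ₚ-congˡ x (+ₚ-cong (≈-refl {binom (suc ℓ) a}) (-ₚ-cong symm)) ⟩
    closedUp (suc ℓ) a                                ∎
    where
    open ≈-Reasoning
    x = q^ (suc ℓ ∸ a)
    arith : ∀ a k → a + (suc k + a) ≡ suc (a + a + k)
    arith = solveℕ-∀
    symm : binom (suc ℓ) a ≈ binom (suc ℓ) (suc k + a)
    symm = subst (λ m → binom m a ≈ binom m (suc k + a))
      (≡.trans (arith a k) (≡.trans eq (+-identityʳ (suc ℓ)))) (binom-sym a (suc k + a))
  totalUp-closed (suc ℓ) zero (suc e) eq = begin
    totalUp k (suc ℓ) (suc e)                            ≈⟨ totalUp-suc k ℓ e ⟩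
    totalUp k ℓ e +ₚ q^ suc ℓ *ₚ total k ℓ (suc e)       ≈⟨ +ₚ-cong (totalUp-unreachable ℓ e (<⇒≤ ℓ+e<k))
                                                              (*ₚ-congˡ (q^ suc ℓ) (total-closed ℓ zero (suc e) (suc-injective eq))) ⟩
    q^ suc ℓ *ₚ closedTotal ℓ 0                          ≈⟨ *ₚ-congˡ (q^ suc ℓ) (+ₚ-cong (≈-refl {1ₚ}) (-ₚ-cong
                                                              (≈-trans (*ₚ-≈0 (q^ suc k) (binom-k+0 (<⇒≤ ℓ<k))) (≈-sym (binom-k+0 ℓ<k))))) ⟩
    closedUp (suc ℓ) 0                                   ∎
    where
    open ≈-Reasoning
    ℓ+e<k : ℓ + e < k
    ℓ+e<k = ≤-reflexive (≡.trans (≡.sym (+-suc ℓ e)) (≡.sym (suc-injective eq)))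
    ℓ<k : suc ℓ < suc k
    ℓ<k = s≤s (≤-trans (s≤s (m≤m+n ℓ e)) ℓ+e<k)
  totalUp-closed (suc ℓ) (suc a) (suc e) eq =
    ≈-trans (totalUp-suc k ℓ e)
      (≈-trans (+ₚ-cong (totalUp-closed ℓ a e eq′)
                        (*ₚ-congˡ (q^ suc ℓ) (total-closed ℓ (suc a) (suc e) (suc-injective eq))))
               (closedUp-suc ℓ a))
    where
    eq′ : suc (a + a + k) ≡ ℓ + e
    eq′ = suc-injective (≡.trans (cong (λ c → suc (c + k)) (≡.sym (+-suc a a)))
                          (≡.trans (suc-injective eq) (+-suc ℓ e)))

-- Factorial formulas for the closed form and for `gauss`.

gauss-≤ : ∀ c d → (num (gauss (c + d) c) ≡ [ c + d ]!q) × (den (gauss (c + d) c) ≡ [ c ]!q *ₚ [ d ]!q)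
gauss-≤ c d rewrite dec-true (c ≤? c + d) (m≤m+n c d) | m+n∸m≡n c d = refl , refl

gauss-> : ∀ {n j} → n < j → num (gauss n j) ≡ 0ₚ
gauss-> {n} {j} n<j rewrite dec-false (j ≤? n) (<⇒≱ n<j) = refl

module _ (a k : ℕ) where
  private
    -- For a = n - r and k = 2r - 1 these are ℓ = 2n - 1, k + a = n + r - 1 and suc k + a = n + r;
    -- thus `E *ₚ d` is [n+r]! and `F` is [n-r]!.
    ℓ = a + (k + a)
    M = [ ℓ ]!q
    E = [ k + a ]!q
    F = [ a ]!q
    d = [ suc k + a ]q
    y = q^ suc k

  -- For a > 0 this is `binom-factorials` with (a-1)! enlarged to a! by the factor [a]; for a = 0
  -- both sides are zero. The local `go` makes a available for the case split.
  binom-upper : binom ℓ (suc k + a) *ₚ (E *ₚ d *ₚ F) ≈ M *ₚ [ a ]q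
  binom-upper = go a
    where
    go : ∀ a → binom (a + (k + a)) (suc k + a) *ₚ ([ suc k + a ]!q *ₚ [ a ]!q) ≈ [ a + (k + a) ]!q *ₚ [ a ]q
    go zero    = ≈-trans (*ₚ-cong (binom-> (n<1+n (k + 0))) ≈-refl) (≈-sym (*ₚ-zeroʳ [ k + 0 ]!q))
    go (suc a) = begin
      b *ₚ (G *ₚ ([ a ]!q *ₚ [ suc a ]q))                    ≈⟨ solve 4 (λ b g f x → b ⊗ (g ⊗ (f ⊗ x)) ⊜ b ⊗ (g ⊗ f) ⊗ x) ≈-refl b G [ a ]!q [ suc a ]q ⟩
      b *ₚ (G *ₚ [ a ]!q) *ₚ [ suc a ]q                      ≈⟨ *ₚ-cong (subst (λ m → binom m j *ₚ (G *ₚ [ a ]!q) ≈ [ m ]!q) (arith a k) (binom-factorials j a)) ≈-refl ⟩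
      [ suc a + (k + suc a) ]!q *ₚ [ suc a ]q                ∎
      where
      open ≈-Reasoning
      j = suc k + suc a
      b = binom (suc a + (k + suc a)) j
      G = [ j ]!q
      arith : ∀ a k → suc k + suc a + a ≡ suc a + (k + suc a)
      arith = solveℕ-∀

  -- Over the common denominator the numerator is [n+r] - q^(2r) [n-r] = [2r].
  closedTotal-factorials : closedTotal k ℓ a *ₚ (E *ₚ d *ₚ F) ≈ M *ₚ [ suc k ]q
  closedTotal-factorials = begin
    (b -ₚ y *ₚ c) *ₚ (E *ₚ d *ₚ F)
      ≈⟨ solve 6 (λ b c y e d f → (b ⊕ ⊝ (y ⊗ c)) ⊗ (e ⊗ d ⊗ f) ⊜ b ⊗ (f ⊗ e) ⊗ d ⊕ ⊝ (y ⊗ (c ⊗ (e ⊗ d ⊗ f)))) ≈-refl b c y E d F ⟩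
    b *ₚ (F *ₚ E) *ₚ d -ₚ y *ₚ (c *ₚ (E *ₚ d *ₚ F))
      ≈⟨ +ₚ-cong (*ₚ-cong (binom-factorials a (k + a)) ([]q-+ (suc k) a)) (-ₚ-cong (*ₚ-congˡ y binom-upper)) ⟩
    M *ₚ ([ suc k ]q +ₚ y *ₚ [ a ]q) -ₚ y *ₚ (M *ₚ [ a ]q)
      ≈⟨ solve 4 (λ m t y s → m ⊗ (t ⊕ y ⊗ s) ⊕ ⊝ (y ⊗ (m ⊗ s)) ⊜ m ⊗ t) ≈-refl M [ suc k ]q y [ a ]q ⟩
    M *ₚ [ suc k ]q
      ∎
    where
    open ≈-Reasoning
    b = binom ℓ a
    c = binom ℓ (suc k + a)

  private
    g₁ = gauss ℓ (k + a)
    g₂ = gauss ℓ (suc k + a)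

  gauss-lower : (num g₁ ≡ M) × (den g₁ ≡ E *ₚ F)
  gauss-lower = subst (λ m → (num (gauss m (k + a)) ≡ [ m ]!q) × (den (gauss m (k + a)) ≡ E *ₚ F))
    (+-comm (k + a) a) (gauss-≤ (k + a) a)

  -- The denominator of `g₂` stays symbolic, since it depends on the case: for a = 0 the lower index
  -- exceeds ℓ and `g₂` is 0 over 1.
  gauss-upper : num g₂ *ₚ (E *ₚ d *ₚ F) ≈ M *ₚ [ a ]q *ₚ den g₂
  gauss-upper = go a
    where
    go : ∀ a → let g = gauss (a + (k + a)) (suc k + a) in
      num g *ₚ ([ suc k + a ]!q *ₚ [ a ]!q) ≈ [ a + (k + a) ]!q *ₚ [ a ]q *ₚ den g
    go zero = ≈-trans (*ₚ-cong (≈-reflexive (gauss-> (n<1+n (k + 0)))) ≈-refl)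
      (≈-sym (*ₚ-cong (*ₚ-zeroʳ [ k + 0 ]!q) ≈-refl))
    go (suc a) with subst (λ m → (num (gauss m j) ≡ [ m ]!q) × (den (gauss m j) ≡ [ j ]!q *ₚ [ a ]!q))
                          (arith a k) (gauss-≤ j a)
      where
      j = suc k + suc a
      arith : ∀ a k → suc k + suc a + a ≡ suc a + (k + suc a)
      arith = solveℕ-∀
    ... | num≡ , den≡ = ≈-trans
      (*ₚ-cong (≈-reflexive num≡) ≈-refl)
      (≈-trans
        (solve 4 (λ m g f x → m ⊗ (g ⊗ (f ⊗ x)) ⊜ m ⊗ x ⊗ (g ⊗ f)) ≈-refl
          [ suc a + (k + suc a) ]!q [ suc k + suc a ]!q [ a ]!q [ suc a ]q)
        (*ₚ-congˡ ([ suc a + (k + suc a) ]!q *ₚ [ suc a ]q) (≈-reflexive (≡.sym den≡))))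

  gauss-difference :
    M *ₚ [ suc k ]q *ₚ (q^ a *ₚ (den g₁ *ₚ den g₂)) ≈
    (1ₚ *ₚ (num g₁ *ₚ den g₂ -ₚ num g₂ *ₚ den g₁)) *ₚ (E *ₚ d *ₚ F)
  gauss-difference = begin
    M *ₚ [ suc k ]q *ₚ (q^ a *ₚ (δ₁ *ₚ δ₂))
      -- The term with [a] is added and subtracted, so that [a] + q^a [k+1] = [k+1+a] can be
      -- contracted to `d`.
      ≈⟨ solve 6 (λ m t x u v s → m ⊗ t ⊗ (x ⊗ (u ⊗ v)) ⊜ m ⊗ v ⊗ u ⊗ (s ⊕ x ⊗ t) ⊕ ⊝ (m ⊗ s ⊗ v ⊗ u)) ≈-refl
           M [ suc k ]q (q^ a) δ₁ δ₂ [ a ]q ⟩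
    M *ₚ δ₂ *ₚ δ₁ *ₚ ([ a ]q +ₚ q^ a *ₚ [ suc k ]q) -ₚ M *ₚ [ a ]q *ₚ δ₂ *ₚ δ₁
      ≈⟨ +ₚ-cong (*ₚ-congˡ (M *ₚ δ₂ *ₚ δ₁) d≈) (-ₚ-cong (*ₚ-cong {r = δ₁} gauss-upper ≈-refl)) ⟨
    M *ₚ δ₂ *ₚ δ₁ *ₚ d -ₚ num g₂ *ₚ (E *ₚ d *ₚ F) *ₚ δ₁
      ≈⟨ +ₚ-cong (*ₚ-cong {r = d} (*ₚ-cong (*ₚ-cong {r = δ₂} (≈-reflexive (≡.sym num≡)) ≈-refl) (≈-reflexive den≡)) ≈-refl) ≈-refl ⟩
    num g₁ *ₚ δ₂ *ₚ (E *ₚ F) *ₚ d -ₚ num g₂ *ₚ (E *ₚ d *ₚ F) *ₚ δ₁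
      ≈⟨ solve 7 (λ n₁ n₂ u v e d f → n₁ ⊗ v ⊗ (e ⊗ f) ⊗ d ⊕ ⊝ (n₂ ⊗ (e ⊗ d ⊗ f) ⊗ u) ⊜ (Κ 1ₚ ⊗ (n₁ ⊗ v ⊕ ⊝ (n₂ ⊗ u))) ⊗ (e ⊗ d ⊗ f)) ≈-refl
           (num g₁) (num g₂) δ₁ δ₂ E d F ⟩
    (1ₚ *ₚ (num g₁ *ₚ δ₂ -ₚ num g₂ *ₚ δ₁)) *ₚ (E *ₚ d *ₚ F)
      ∎
    where
    open ≈-Reasoning
    δ₁ = den g₁
    δ₂ = den g₂
    num≡ = proj₁ gauss-lower
    den≡ = proj₂ gauss-lower
    d≈ : d ≈ [ a ]q +ₚ q^ a *ₚ [ suc k ]q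
    d≈ = ≈-trans (≈-reflexive (cong [_]q (+-comm (suc k) a))) ([]q-+ a (suc k))

theorem1 : (n r : ℕ) → 1 ≤ r → r ≤ n →
    (B n r ≃ fromPoly (majDesSum n r)) ×
    (B n r ≃ (q^- (n ∸ r)) *ᶠ (gauss (2 * n ∸ 1) (n + r ∸ 1) -ᶠ gauss (2 * n ∸ 1) (n + r)))
theorem1 (suc n) (suc r) _ (s≤s r≤n) with m≤n⇒∃[o]m+o≡n r≤n
-- Here a = n - r, which removes every truncated subtraction.
... | a , refl =
    *≈* (≈-trans (*ₚ-identityʳ _)
          (≈-trans (≈-sym (scaledTotal (length≡ r a) (2r≡ r) (n+r≡ r a) (m+n∸m≡n r a)))
                   (*ₚ-cong (≈-sym (majDesSum≈total (r + a) r)) ≈-refl)))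
  , *≈* (scaledDifference (length≡ r a) (2r≡ r) (n+r∸1≡ r a) (n+r≡ r a) (m+n∸m≡n r a))
  where
  k = suc (2 * r)

  length≡ : ∀ r a → r + a + suc (r + a + 0) ≡ a + (suc (2 * r) + a)
  length≡ = solveℕ-∀
  2r≡ : ∀ r → 2 * suc r ≡ suc (suc (2 * r))
  2r≡ = solveℕ-∀
  n+r∸1≡ : ∀ r a → r + a + suc r ≡ suc (2 * r) + a
  n+r∸1≡ = solveℕ-∀
  n+r≡ : ∀ r a → suc (r + a) + suc r ≡ suc (suc (2 * r)) + a
  n+r≡ = solveℕ-∀
  end≡ : ∀ a k → a + a + k ≡ a + (k + a) + 0
  end≡ = solveℕ-∀

  -- The indices are variables with equations, so that matching on `refl` aligns the indices of the
  -- statement with those in a and k.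
  scaledTotal : ∀ {ℓ t s c} → ℓ ≡ a + (k + a) → t ≡ suc k → s ≡ suc k + a → c ≡ a →
    total k ℓ 0 *ₚ ([ s ]!q *ₚ [ c ]!q) ≈ [ ℓ ]!q *ₚ [ t ]q
  scaledTotal refl refl refl refl =
    ≈-trans (*ₚ-cong (total-closed k (a + (k + a)) a 0 (end≡ a k)) ≈-refl) (closedTotal-factorials a k)

  scaledDifference : ∀ {ℓ t b s c} →
    ℓ ≡ a + (k + a) → t ≡ suc k → b ≡ k + a → s ≡ suc k + a → c ≡ a →
    [ ℓ ]!q *ₚ [ t ]q *ₚ (q^ c *ₚ (den (gauss ℓ b) *ₚ den (gauss ℓ s))) ≈
    (1ₚ *ₚ (num (gauss ℓ b) *ₚ den (gauss ℓ s) -ₚ num (gauss ℓ s) *ₚ den (gauss ℓ b))) *ₚ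
      ([ s ]!q *ₚ [ c ]!q)
  scaledDifference refl refl refl refl refl = gauss-difference a k
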